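{- Let $\hat G$ be a connected planar graph embedded on the sphere with $n$ vertices, let $\Delta$ be a positive integer and $\Delta_0=20(\lceil\log_{10/9}n\rceil+1)\Delta$. Let $Z$ be a cycle of $\hat G$ and $\hat{\mathcal{M}}$ a set of demand pairs all of whose vertices lie on $Z$. Let $C$ be a closed $\hat G$-normal curve of length at most $\Delta$ disjoint from $Z$, let $D(Z)$ be the disc with boundary $Z$ that contains $C$, and assume that every vertex $v\in Z$ is connected to a vertex of $C$ by a $\hat G$-normal curve $\gamma(v)$ of length at most $16\Delta_0$ that is contained in $D(Z)$ and internally disjoint from $C$. Let $\hat G'$ be obtained from $\hat G$ by deleting all vertices and edges lying in $D(Z)$ except the vertices and edges of $Z$. Then $\mathrm{OPT}(\hat G',\hat{\mathcal{M}})\geq\Omega\left(\frac{\mathrm{OPT}(\hat G,\hat{\mathcal{M}})}{\Delta_0^2\log n}\right)$.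
   Context: A curve on the sphere is $\hat G$-normal if it intersects the drawing of $\hat G$ only at vertices; its length is the number of vertices of $\hat G$ it contains. For a graph $H$, $\mathrm{OPT}(H,\hat{\mathcal{M}})$ is the maximum number of demand pairs of $\hat{\mathcal{M}}$ that can be simultaneously connected by pairwise node-disjoint paths in $H$. -}

module Defs where

open import Data.Bool using (Bool; not)
open import Data.Fin using (Fin; _≟_)
open import Data.Fin.Subset using (Subset) renaming (_∈_ to _∈ˢ_)
open import Data.List using (List; []; _∷_; _∷ʳ_; map; length; head; last; deduplicate)
open import Data.List.Membership.Propositional using (_∈_; _∉_)
open import Data.List.Relation.Binary.Disjoint.Propositional using (Disjoint)
open import Data.List.Relation.Unary.All using (All)
open import Data.List.Relation.Unary.Linked using (Linked)
open import Data.List.Relation.Unary.Unique.Propositional using (Unique)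
open import Data.Maybe using (just)
open import Data.Nat using (ℕ; _+_; _*_; _^_; _≤_; _<_)
open import Data.Nat.GeneralisedArithmetic using (fold)
open import Data.Product using (Σ; ∃; _×_; _,_; proj₁; proj₂)
open import Data.Sum using (_⊎_)
open import Data.Unit using (⊤)
open import Data.Vec using (lookup)
open import Function.Base using (_∘_)
open import Function.Bundles using (_↔_; _⇔_; Inverse)
open import Level using (0ℓ)
open import Relation.Binary.Construct.Closure.ReflexiveTransitive using (Star; ε; _◅_)
open import Relation.Binary.PropositionalEquality using (_≡_; _≢_)
open import Relation.Nullary using (¬_)
open import Relation.Unary using (Pred)

-- L = ⌈ log_{10/9} n ⌉, i.e. the least L with n ≤ (10/9)^L.
IsCeilLog₁₀⁄₉ : ℕ → ℕ → Set
IsCeilLog₁₀⁄₉ n L =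
  (n * 9 ^ L ≤ 10 ^ L) × (∀ j → n * 9 ^ j ≤ 10 ^ j → L ≤ j)

-- Finite simple graphs with n vertices and m edges.  A dart is an edge together
-- with one of its two orientations.
record Graph : Set where
  field
    n m : ℕ

  Vertex : Set
  Vertex = Fin n

  Edge : Set
  Edge = Fin m

  Dart : Set
  Dart = Edge × Bool

  edge : Dart → Edge
  edge = proj₁

  rev : Dart → Dart
  rev (e , b) = e , not b

  field
    src : Dart → Vertex

  tgt : Dart → Vertex
  tgt = src ∘ rev

  field
    loopless    : ∀ d → src d ≢ tgt d
    no-parallel : ∀ d d′ → src d ≡ src d′ → tgt d ≡ tgt d′ → d ≡ d′

  Adjacent : Vertex → Vertex → Set
  Adjacent u v = ∃ λ d → src d ≡ u × tgt d ≡ v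

  Connected : Set
  Connected = ∀ u v → Star Adjacent u v

-- A subgraph of G, given by the vertices and the edges that are not deleted.
-- Deleting a vertex deletes its edges, so keepE may hold of an edge whose end
-- is deleted; paths never use such an edge.
record Subgraph (G : Graph) : Set₁ where
  open Graph G
  field
    keepV : Pred Vertex 0ℓ
    keepE : Pred Edge 0ℓ

whole : (G : Graph) → Subgraph G
whole G = record { keepV = λ _ → ⊤ ; keepE = λ _ → ⊤ }

module Routing {G : Graph} (H : Subgraph G) where
  open Graph G
  open Subgraph H

  AdjacentIn : Vertex → Vertex → Set
  AdjacentIn u v = ∃ λ d → keepE (edge d) × src d ≡ u × tgt d ≡ v

  record IsPath (s t : Vertex) (p : List Vertex) : Set where
    field
      starts   : head p ≡ just s
      ends     : last p ≡ just t
      inside   : All keepV p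
      adjacent : Linked AdjacentIn p
      simple   : Unique p

  -- k demand pairs of M can be connected by pairwise node-disjoint paths.
  -- Disjointness of the (non-empty) paths makes the k pairs distinct, so
  -- repetitions in the list M are irrelevant.
  record Routable (M : List (Vertex × Vertex)) (k : ℕ) : Set where
    field
      pair     : Fin k → Vertex × Vertex
      demand   : ∀ i → pair i ∈ M
      path     : Fin k → List Vertex
      connects : ∀ i → IsPath (proj₁ (pair i)) (proj₂ (pair i)) (path i)
      disjoint : ∀ i j → i ≢ j → Disjoint (path i) (path j)

  IsOPT : List (Vertex × Vertex) → ℕ → Set
  IsOPT M k = Routable M k × (∀ j → Routable M j → j ≤ k)

-- The cycle is directed by its list of darts.
record Cycle (G : Graph) : Set where
  open Graph G
  field
    first : Dart
    rest  : List Dart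

  darts : List Dart
  darts = first ∷ rest

  vertices : List Vertex
  vertices = map src darts

  edges : List Edge
  edges = map edge darts

  field
    closed   : Linked (λ d d′ → tgt d ≡ src d′) (darts ∷ʳ first)
    distinct : Unique vertices
    proper   : 3 ≤ length darts

SameOrbit : {A : Set} → (A → A) → A → A → Set
SameOrbit g a b = ∃ λ i → fold a g i ≡ b

-- An embedding of a connected graph on the sphere, up to homeomorphism, as a
-- rotation system of Euler characteristic 2: rot d is the clockwise successor of
-- d among the darts leaving src d.  The orbits of φ trace the faces, keeping the
-- face on the left, and d also names the corner of face d at src d lying between
-- the dart preceding d in the rotation and d.
-- (The one-vertex graph, whose only face has no corner, is not covered.)
record SphereEmbedding (G : Graph) : Set where
  open Graph G
  field
    rotation     : Dart ↔ Dart

  rot : Dart → Dart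
  rot = Inverse.to rotation

  φ : Dart → Dart
  φ = rot ∘ rev

  field
    vertex-orbit : ∀ d d′ → src d ≡ src d′ ⇔ SameOrbit rot d d′
    f            : ℕ
    face         : Dart → Fin f
    face-onto    : ∀ F → ∃ λ d → face d ≡ F
    face-orbit   : ∀ d d′ → face d ≡ face d′ ⇔ SameOrbit φ d d′
    euler        : n + f ≡ m + 2

  Face : Set
  Face = Fin f

  -- One passage of a normal curve through the interior of a face: it leaves u
  -- through a corner of the face and reaches v through a corner of the same face.
  record Chord (u v : Vertex) : Set where
    field
      out into  : Dart
      out-at    : src out ≡ u
      into-at   : src into ≡ v
      same-face : face out ≡ face into

  -- Curves meeting the drawing only at vertices and with both ends at vertices.
  NormalCurve : Vertex → Vertex → Set
  NormalCurve = Star Chord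

  visits : ∀ {u v} → NormalCurve u v → List Vertex
  visits {u} ε       = u ∷ []
  visits {u} (_ ◅ γ) = u ∷ visits γ

  visitsBeforeEnd : ∀ {u v} → NormalCurve u v → List Vertex
  visitsBeforeEnd ε           = []
  visitsBeforeEnd {u} (_ ◅ γ) = u ∷ visitsBeforeEnd γ

  corners : ∀ {u v} → NormalCurve u v → List (Dart × Dart)
  corners ε       = []
  corners (c ◅ γ) = (Chord.out c , Chord.into c) ∷ corners γ

  -- The number of vertices on the curve; a vertex visited repeatedly counts once.
  curveLength : ∀ {u v} → NormalCurve u v → ℕ
  curveLength γ = length (deduplicate _≟_ (visits γ))

  -- The four corners are distinct, lie on one face, and occur in this cyclic
  -- order along its boundary.
  CyclicOrder : Dart → Dart → Dart → Dart → Set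
  CyclicOrder a b c d =
    ∃ λ i → ∃ λ j → ∃ λ k →
      0 < i × i < j × j < k
      × fold a φ i ≡ b × fold a φ j ≡ c × fold a φ k ≡ d
      × (∀ l → 0 < l → l ≤ k → fold a φ l ≢ a)

  -- Two passages through a common face are forced to intersect in its interior
  -- exactly when their end corners interleave.
  Cross : Dart × Dart → Dart × Dart → Set
  Cross (a , b) (c , d) = CyclicOrder a c b d ⊎ CyclicOrder a d b c

  -- The starting vertex of γ is also required to avoid C; only the final vertex
  -- may lie on C.
  record InternallyDisjoint {u v w} (γ : NormalCurve u v) (C : NormalCurve w w) : Set where
    field
      at-vertices : Disjoint (visitsBeforeEnd γ) (visits C)
      in-faces    : ∀ {p q} → p ∈ corners γ → q ∈ corners C → ¬ Cross p q

  -- A disc bounded by Z is given by the set D of faces in it.  The edges on the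
  -- frontier of D are exactly those of Z.
  IsDiscBoundedBy : Cycle G → Subset f → Set
  IsDiscBoundedBy Z D =
    ∀ d → edge d ∈ Cycle.edges Z ⇔ lookup D (face d) ≢ lookup D (face (rev d))

  -- Vertices and edges of the closed disc, boundary included.
  VertexInDisc : Subset f → Vertex → Set
  VertexInDisc D v = ∃ λ d → src d ≡ v × face d ∈ˢ D

  EdgeInDisc : Subset f → Edge → Set
  EdgeInDisc D e = ∃ λ d → edge d ≡ e × face d ∈ˢ D

  record ContainedIn (D : Subset f) {u v} (γ : NormalCurve u v) : Set where
    field
      vertices-in : All (VertexInDisc D) (visits γ)
      faces-in    : All (λ p → face (proj₁ p) ∈ˢ D) (corners γ)

  -- Delete everything in the closed disc D except Z itself.
  emptyDisc : Cycle G → Subset f → Subgraph G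
  emptyDisc Z D = record
    { keepV = λ v → v ∈ Cycle.vertices Z ⊎ ¬ VertexInDisc D v
    ; keepE = λ e → e ∈ Cycle.edges Z ⊎ ¬ EdgeInDisc D e
    }

{-# OPTIONS --safe #-}

-- Let ρ = 33 Δ₀. Any two vertices of Z are joined inside D, along γ and C, by a normal curve through at most ρ
-- vertices. Each such curve is hit by at most ρ of the optimal disjoint paths, so the demand pairs contain a
-- subfamily of size at least opt / 2ρ in which no path meets the inner curve of another pair. Two pairs of it that
-- interleave on Z would contradict the parity of intersection numbers on the sphere, so their arcs are laminar.
-- Keep every K-th nesting depth, K = ρ + 6. For a kept arc i let X i consist of the vertices that are reached
-- from a kept arc g levels deeper by an outer normal curve with at most g chords, and route i outside D along the
-- frontier of X i. If two of these routes met, an outer curve together with an inner one would separate the ends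
-- of more paths than it has vertices. No logarithm is lost.
--
-- The two topological inputs are mod 2. On the sphere every even edge set bounds a set of faces
-- (tree-cotree decomposition and Euler's formula), which gives colourings that jump exactly along a given
-- closed curve. That the frontier of X i joins the ends of the arc follows by double counting over outer faces.
module Submission where

open import Defs
open import Algebra.Bundles using (CommutativeRing)
open import Algebra.Properties.CommutativeSemigroup using (x∙yz≈y∙xz; interchange)
open import Data.Bool using (Bool; true; false; not; _∧_; _xor_; if_then_else_)
import Data.Bool.Properties as 𝔹
open import Data.Empty using (⊥; ⊥-elim)
open import Data.Fin as Fin using (Fin; zero; suc; punchIn)
import Data.Fin.Properties as Finₚ
open import Data.Fin.Subset using (Subset)
open import Data.List using (List; []; _∷_; _∷ʳ_; _++_; map; filter; length; head; last; deduplicate; lookup; allFin)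
import Data.List.Properties as Listₚ
open import Data.List.Membership.Propositional using (_∈_; _∉_; find; lose)
open import Data.List.Membership.Propositional.Properties
  using (∈-lookup; ∈-allFin; ∈-map⁺; ∈-map⁻; ∈-++⁺ˡ; ∈-++⁺ʳ; ∈-++⁻; ∈-filter⁻; ∈-deduplicate⁺)
open import Data.List.Relation.Binary.Disjoint.Propositional using (Disjoint)
open import Data.List.Relation.Unary.All as All using (All; []; _∷_)
open import Data.List.Relation.Unary.AllPairs as AllPairs using (AllPairs; []; _∷_)
open import Data.List.Relation.Unary.Any as Any using (here; there; index)
open import Data.List.Relation.Unary.Any.Properties using (lookup-index)
open import Data.List.Relation.Unary.Linked as Linked using (Linked; []; [-]; _∷_)
open import Data.List.Relation.Unary.Unique.Propositional using (Unique)
import Data.List.Relation.Unary.Unique.Propositional.Properties as Uniqueₚ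
open import Data.Maybe using (just)
open import Data.Nat using (ℕ; zero; suc; _+_; _*_; _∸_; _^_; _/_; _%_; _≤_; _<_; z≤n; s≤s; s≤s⁻¹; NonZero)
open import Data.Nat.DivMod using (m≡m%n+[m/n]*n; m%n<n)
open import Data.Nat.GeneralisedArithmetic using (fold)
open import Data.Nat.ListAction using (sum)
open import Data.Nat.Logarithm using (⌊log₂_⌋; ⌊log₂⌋-mono-≤; ⌊log₂[2^n]⌋≡n)
import Data.Nat.Properties as ℕₚ
open import Data.Nat.Solver using (module +-*-Solver)
open import Data.Product using (Σ; ∃; _×_; _,_; proj₁; proj₂)
open import Data.Product.Function.NonDependent.Propositional using (_×-↔_)
open import Data.Sum as Sum using (_⊎_; inj₁; inj₂)
open import Data.Unit using (⊤; tt)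
import Data.Vec as Vec
import Data.Vec.Properties as Vecₚ
open import Function.Base using (_∘_; id)
open import Function.Bundles using (_↔_; mk↔ₛ′; Inverse; Equivalence)
open import Function.Construct.Composition using (_↔-∘_)
open import Function.Construct.Identity using (↔-id)
open import Function.Construct.Symmetry using (↔-sym)
open import Relation.Binary.Construct.Closure.ReflexiveTransitive using (Star; ε; _◅_; _◅◅_; gmap; reverse)
open import Relation.Binary.Definitions using (DecidableEquality; tri<; tri≈; tri>)
open import Relation.Binary.PropositionalEquality
open import Relation.Nullary using (¬_; Dec; yes; no; does)
open import Relation.Nullary.Decidable using (_×-dec_; _⊎-dec_; ¬?; map′)
open import Relation.Unary using (Decidable)

open import Algebra.Properties.CommutativeMonoid.Sum
  (CommutativeRing.+-commutativeMonoid 𝔹.xor-∧-commutativeRing)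
  using (sum-cong-≗; sum-replicate-zero; ∑-distrib-+; sum-permute; sum-remove) renaming (sum to ⨁)

-- The optimal paths may use the disc freely, so it is not clear at the outset that the ends of a
-- demand pair are even connected outside it. The regions `X i` have to meet two opposite demands.
-- They must grow: an outer face that meets a region nested strictly inside `i` must have all its
-- vertices in `X i`, which is what keeps the frontier of `X i` connected; one chord per level is
-- exactly this growth. And they must stay small: a region nested inside `i` must not reach `Z`
-- beyond the arc of `i`, and the regions of two unrelated arcs must not touch. Growth by `g` chords
-- is affordable because at least `g * K - 1` arcs lie between two kept nested arcs that are `g`
-- levels apart, and each of their paths must hit any outer curve leading across them or the inner
-- curve that closes it up. Together these have at most `2 * g + 2 + ρ` vertices, which is too few.

xor-≡ : ∀ {a b} → a xor b ≡ false → a ≡ b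
xor-≡ {false} {false} _ = refl
xor-≡ {true}  {true}  _ = refl

≡-xor : ∀ {a b} → a ≡ b → a xor b ≡ false
≡-xor {a} refl = 𝔹.xor-same a

xor-interchange : ∀ a b c d → (a xor b) xor (c xor d) ≡ (a xor c) xor (b xor d)
xor-interchange = interchange (CommutativeRing.+-commutativeSemigroup 𝔹.xor-∧-commutativeRing)

+-exchange : ∀ a b c → a + (b + c) ≡ b + (a + c)
+-exchange = x∙yz≈y∙xz ℕₚ.+-commutativeSemigroup

xor-cancelˡ : ∀ a b → a xor (a xor b) ≡ b
xor-cancelˡ a b = trans (sym (𝔹.xor-assoc a a b)) (cong (_xor b) (𝔹.xor-same a))

-- Sums mod 2 over a finite type

module Parity {A : Set} {N : ℕ} (δ : Fin N ↔ A) where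
  open Inverse δ using (to; from; strictlyInverseˡ; strictlyInverseʳ)

  abstract
    ∑ : (A → Bool) → Bool
    ∑ g = ⨁ (g ∘ to)

    ∑-cong : ∀ {g h} → (∀ x → g x ≡ h x) → ∑ g ≡ ∑ h
    ∑-cong eq = sum-cong-≗ (λ i → eq (to i))

    ∑-false : ∀ {g} → (∀ x → g x ≡ false) → ∑ g ≡ false
    ∑-false eq = trans (∑-cong eq) (sum-replicate-zero N)

    ∑-xor : ∀ g h → ∑ (λ x → g x xor h x) ≡ ∑ g xor ∑ h
    ∑-xor g h = ∑-distrib-+ (g ∘ to) (h ∘ to)

    ∑-bij : ∀ (π : A ↔ A) g → ∑ g ≡ ∑ (g ∘ Inverse.to π)
    ∑-bij π g = trans (sum-permute (g ∘ to) ((↔-sym δ ↔-∘ π) ↔-∘ δ))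
      (sum-cong-≗ λ i → cong g (strictlyInverseˡ (Inverse.to π (to i))))

    ∑-single : ∀ a g → (∀ x → x ≢ a → g x ≡ false) → ∑ g ≡ g a
    ∑-single a g others = on-Fin N (g ∘ to) (from a)
      (λ j j≢ → others (to j) (λ eq → j≢ (trans (sym (strictlyInverseʳ j)) (cong from eq))))
      (cong g (strictlyInverseˡ a))
      where
      on-Fin : ∀ n (h : Fin n → Bool) i → (∀ j → j ≢ i → h j ≡ false) → h i ≡ g a → ⨁ h ≡ g a
      on-Fin (suc n) h i z eq = trans (sum-remove {i = i} h)
        (trans (cong (h i xor_) (trans (sum-cong-≗ (λ j → z (punchIn i j) (Finₚ.punchInᵢ≢i i j))) (sum-replicate-zero n)))
               (trans (𝔹.xor-identityʳ (h i)) eq))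

-- Lists without repetitions

unique-lookup-injective : {A : Set} {xs : List A} → Unique xs → ∀ {i j} → lookup xs i ≡ lookup xs j → i ≡ j
unique-lookup-injective (x∉ ∷ u) {zero} {zero} eq = refl
unique-lookup-injective (x∉ ∷ u) {zero} {suc j} eq = ⊥-elim (All.lookup x∉ (∈-lookup j) eq)
unique-lookup-injective (x∉ ∷ u) {suc i} {zero} eq = ⊥-elim (All.lookup x∉ (∈-lookup i) (sym eq))
unique-lookup-injective (x∉ ∷ u) {suc i} {suc j} eq = cong suc (unique-lookup-injective u eq)

unique-⊆⇒length-≤ : {A : Set} {xs ys : List A} → Unique xs → (∀ {x} → x ∈ xs → x ∈ ys) → length xs ≤ length ys
unique-⊆⇒length-≤ {xs = xs} {ys} u sub = Finₚ.injective⇒≤ {f = λ i → index (sub (∈-lookup {xs = xs} i))}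
  (λ {i} {j} eq → unique-lookup-injective u
    (trans (lookup-index (sub (∈-lookup i))) (trans (cong (lookup ys) eq) (sym (lookup-index (sub (∈-lookup j)))))))

∉⇒All≢ : {A : Set} {x : A} {xs : List A} → x ∉ xs → All (x ≢_) xs
∉⇒All≢ x∉ = All.tabulate (λ y∈ eq → x∉ (subst (_∈ _) (sym eq) y∈))

unique⇒length≤n : ∀ {n} {xs : List (Fin n)} → Unique xs → length xs ≤ n
unique⇒length≤n {n} {xs} u = subst (length xs ≤_) (Listₚ.length-tabulate id) (unique-⊆⇒length-≤ u (λ _ → ∈-allFin _))

unique-full : ∀ {n} {xs : List (Fin n)} → Unique xs → n ≤ length xs → ∀ e → e ∈ xs
unique-full {n} {xs} u len e with Any.any? (e Finₚ.≟_) xs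
... | yes e∈ = e∈
... | no e∉ = ⊥-elim (ℕₚ.<⇒≱ (unique⇒length≤n (∉⇒All≢ e∉ ∷ u)) len)

-- Growing trees in multigraphs

rev′ : ∀ {m} → Fin m × Bool → Fin m × Bool
rev′ (e , b) = e , not b

rev′-involutive : ∀ {m} (d : Fin m × Bool) → rev′ (rev′ d) ≡ d
rev′-involutive (e , b) = cong (e ,_) (𝔹.not-involutive b)

same-edge : ∀ {m} {d d′ : Fin m × Bool} → proj₁ d ≡ proj₁ d′ → d ≡ d′ ⊎ d ≡ rev′ d′
same-edge {d = e , false} {.e , false} refl = inj₁ refl
same-edge {d = e , false} {.e , true}  refl = inj₂ refl
same-edge {d = e , true}  {.e , false} refl = inj₂ refl
same-edge {d = e , true}  {.e , true}  refl = inj₁ refl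

abstract
  _≟ᵈ_ : ∀ {m} → DecidableEquality (Fin m × Bool)
  (e , b) ≟ᵈ (e′ , b′) = map′ (λ { (refl , refl) → refl }) (λ { refl → refl , refl }) ((e Finₚ.≟ e′) ×-dec (b 𝔹.≟ b′))

abstract
  anyDart? : ∀ {m} {P : Fin m × Bool → Set} → Decidable P → Dec (∃ P)
  anyDart? P? = map′ (λ { (e , inj₁ p) → _ , p ; (e , inj₂ p) → _ , p }) (λ { ((e , true) , p) → e , inj₁ p ; ((e , false) , p) → e , inj₂ p })
    (Finₚ.any? (λ e → P? (e , true) ⊎-dec P? (e , false)))

-- One construction with three uses: a spanning tree for `s = src`, a spanning tree of the dual for
-- `s = face` (reversing a dart passes to the face across its edge), and the component in which a
-- new route is sought.
module Growth {m k : ℕ} (s : Fin m × Bool → Fin k)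
  {Allowed : Fin m × Bool → Set} (allowed? : Decidable Allowed) (root : Fin k) where

  private
    t : Fin m × Bool → Fin k
    t = s ∘ rev′

  visited : List (Fin m × Bool) → List (Fin k)
  visited []       = root ∷ []
  visited (d ∷ ds) = t d ∷ visited ds

  data Grown : List (Fin m × Bool) → Set where
    []  : Grown []
    grow : ∀ {d ds} → Allowed d → s d ∈ visited ds → t d ∉ visited ds → Grown ds → Grown (d ∷ ds)

  Closed : List (Fin m × Bool) → Set
  Closed ds = ∀ d → Allowed d → s d ∈ visited ds → t d ∈ visited ds

  _∈?_ : (x : Fin k) (xs : List (Fin k)) → Dec (x ∈ xs)
  x ∈? xs = Any.any? (x Finₚ.≟_) xs

  visited-unique : ∀ {ds} → Grown ds → Unique (visited ds)
  visited-unique []             = [] ∷ []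
  visited-unique (grow _ _ new g) = ∉⇒All≢ new ∷ visited-unique g

  root∈visited : ∀ ds → root ∈ visited ds
  root∈visited []       = here refl
  root∈visited (_ ∷ ds) = there (root∈visited ds)

  private
    extend : ∀ fuel ds → Grown ds → k < length (visited ds) + fuel → ∃ λ ds → Grown ds × Closed ds
    -- Each attachment spends one unit of fuel and adds a new vertex, so running out would mean more
    -- than `k` distinct visited vertices.
    extend zero ds g bound = ⊥-elim (ℕₚ.<⇒≱ (subst (k <_) (ℕₚ.+-identityʳ _) bound) (unique⇒length≤n (visited-unique g)))
    extend (suc fuel) ds g bound
      with anyDart? (λ d → allowed? d ×-dec (s d ∈? visited ds) ×-dec ¬? (t d ∈? visited ds))
    ... | yes (d , a , old , new) = extend fuel (d ∷ ds) (grow a old new g) (subst (k <_) (ℕₚ.+-suc _ fuel) bound)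
    ... | no none = ds , g , closed
      where
      closed : Closed ds
      closed d a old with t d ∈? visited ds
      ... | yes p = p
      ... | no new = ⊥-elim (none (d , a , old , new))

  abstract
    growth : ∃ λ ds → Grown ds × Closed ds
    growth = extend k [] [] ℕₚ.≤-refl

  ends-visited : ∀ {ds} → Grown ds → ∀ {d} → d ∈ ds → s d ∈ visited ds × t d ∈ visited ds
  ends-visited (grow _ old _ g) (here refl) = there old , here refl
  ends-visited (grow _ _ _ g)   (there d∈)  = let p , q = ends-visited g d∈ in there p , there q

  grown-allowed : ∀ {ds} → Grown ds → All Allowed ds
  grown-allowed [] = []
  grown-allowed (grow a _ _ g) = a ∷ grown-allowed g

  edge-visited : ∀ {ds} → Grown ds → ∀ {x} → proj₁ x ∈ map proj₁ ds → s x ∈ visited ds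
  edge-visited {ds} g {x} e∈ with ∈-map⁻ proj₁ e∈
  ... | d , d∈ , eq with same-edge {d = x} {d} eq
  ...   | inj₁ refl = proj₁ (ends-visited g d∈)
  ...   | inj₂ refl = proj₂ (ends-visited g d∈)

  edges-unique : ∀ {ds} → Grown ds → Unique (map proj₁ ds)
  edges-unique [] = []
  edges-unique (grow _ _ new g) = ∉⇒All≢ (new ∘ edge-visited g) ∷ edges-unique g

  length-visited : ∀ ds → length (visited ds) ≡ suc (length ds)
  length-visited []       = refl
  length-visited (_ ∷ ds) = cong suc (length-visited ds)

  spanning⇒size : ∀ {ds} → (∀ v → v ∈ visited ds) → k ≤ suc (length ds)
  spanning⇒size {ds} all = subst₂ _≤_ (Listₚ.length-tabulate id) (length-visited ds)
    (unique-⊆⇒length-≤ (Uniqueₚ.allFin⁺ k) (λ _ → all _))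

  -- A vertex is linked to the source of the dart that attached it, which was visited earlier. The
  -- path is simple because the earlier stage does not contain the vertex.
  path-to : ∀ {ds} → Grown ds → ∀ {v} → v ∈ visited ds → ∃ λ p →
    head p ≡ just v × last p ≡ just root × Unique p × (∀ {x} → x ∈ p → x ∈ visited ds)
    × Linked (λ a b → ∃ λ d → Allowed d × t d ≡ a × s d ≡ b) p
  path-to [] (here refl) = root ∷ [] , refl , refl , [] ∷ [] , id , [-]
  path-to (grow _ _ _ g) (there v∈) =
    let p , h , l , u , sub , lk = path-to g v∈ in p , h , l , u , there ∘ sub , lk
  path-to (grow {d} {ds} a old new g) (here refl) with path-to g old
  ... | x ∷ p , refl , l , u , sub , lk =
    t d ∷ x ∷ p , refl , l , ∉⇒All≢ (new ∘ sub) ∷ u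
    , (λ { (here eq) → here eq ; (there y∈) → there (sub y∈) })
    , (d , a , refl , refl) ∷ lk

-- Cycles mod 2 bound on the sphere

module Sphere {G : Graph} (connected : Graph.Connected G) (emb : SphereEmbedding G) (d₀ : Graph.Dart G) where
  open Graph G
  open SphereEmbedding emb

  open Parity ((↔-id (Fin m) ×-↔ Finₚ.2↔Bool) ↔-∘ Finₚ.*↔× {m} {2}) public

  rev↔ : Dart ↔ Dart
  rev↔ = mk↔ₛ′ rev rev rev′-involutive rev′-involutive

  φ↔ : Dart ↔ Dart
  φ↔ = rotation ↔-∘ rev↔

  face-φ : ∀ d → face (φ d) ≡ face d
  face-φ d = sym (Equivalence.from (face-orbit d (φ d)) (1 , refl))

  φ-rev : ∀ d → φ (rev d) ≡ rot d
  φ-rev d = cong rot (rev′-involutive d)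

  face-rot : ∀ d → face (rot d) ≡ face (rev d)
  face-rot d = trans (cong face (sym (φ-rev d))) (face-φ (rev d))

  src-rot : ∀ d → src (rot d) ≡ src d
  src-rot d = sym (Equivalence.from (vertex-orbit d (rot d)) (1 , refl))

  src-φ : ∀ d → src (φ d) ≡ tgt d
  src-φ d = src-rot (rev d)

  tgt-rev : ∀ d → tgt (rev d) ≡ src d
  tgt-rev d = cong src (rev′-involutive d)

  -- The boundary mod 2: for symmetric `E` it is the parity of the degree of `w` in the edge set
  -- `E`.
  ∂ : (Dart → Bool) → Vertex → Bool
  ∂ E w = ∑ (λ d → does (src d Finₚ.≟ w) ∧ E d)

  ∂-xor : ∀ E F w → ∂ (λ d → E d xor F d) w ≡ ∂ E w xor ∂ F w
  ∂-xor E F w = trans (∑-cong (λ d → 𝔹.∧-distribˡ-xor (does (src d Finₚ.≟ w)) (E d) (F d))) (∑-xor _ _)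

  ∂-rotation : ∀ c w → ∂ (λ d → c d xor c (rot d)) w ≡ false
  ∂-rotation c w = trans (∂-xor c (c ∘ rot) w) (≡-xor
    (trans (∑-bij rotation _) (∑-cong (λ d → cong (λ v → does (v Finₚ.≟ w) ∧ c (rot d)) (src-rot d)))))

  -- Around `w` the face across `d` is the face of the next dart `rot d`, so the jumps of a face
  -- colouring cancel over a full turn.
  ∂-faces : ∀ (c : Face → Bool) w → ∂ (λ d → c (face d) xor c (face (rev d))) w ≡ false
  ∂-faces c w = trans (∑-cong (λ d → cong (λ x → does (src d Finₚ.≟ w) ∧ (c (face d) xor c x)) (sym (face-rot d)))) (∂-rotation (c ∘ face) w)

  flip-rev : ∀ (c : Face → Bool) d → c (face (rev d)) xor c (face (rev (rev d))) ≡ c (face d) xor c (face (rev d))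
  flip-rev c d = trans (cong (λ x → c (face (rev d)) xor c (face x)) (rev′-involutive d))
    (𝔹.xor-comm (c (face (rev d))) (c (face d)))

  -- `rot` reaches every dart at a vertex and `rev` passes along an edge, so in a connected graph
  -- the two act transitively on darts.
  constant-on-darts : ∀ (c : Dart → Bool) → (∀ d → c (rot d) ≡ c d) → (∀ d → c (rev d) ≡ c d) → ∀ d d′ → c d ≡ c d′
  constant-on-darts c c-rot c-rev d d′ = go (connected (src d) (src d′)) refl refl
    where
    orbit : ∀ a k → c (fold a rot k) ≡ c a
    orbit a zero    = refl
    orbit a (suc k) = trans (c-rot _) (orbit a k)
    at-vertex : ∀ a b → src a ≡ src b → c a ≡ c b
    at-vertex a b eq = let k , eq′ = Equivalence.to (vertex-orbit a b) eq in trans (sym (orbit a k)) (cong c eq′)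
    go : ∀ {u v a b} → Star Adjacent u v → src a ≡ u → src b ≡ v → c a ≡ c b
    go {a = a} {b} ε refl eq = at-vertex a b (sym eq)
    go {a = a} ((e , se , te) ◅ w) refl eq = trans (at-vertex a e (sym se)) (trans (sym (c-rev e)) (go w te eq))

  module Primal = Growth src {λ _ → ⊤} (λ _ → yes tt) (src d₀)

  tree : ∃ λ ds → Primal.Grown ds × Primal.Closed ds
  tree = Primal.growth

  treeDarts : List Dart
  treeDarts = proj₁ tree

  tree-spans : ∀ v → v ∈ Primal.visited treeDarts
  tree-spans v = go (connected (src d₀) v) (Primal.root∈visited treeDarts)
    where
    go : ∀ {u v} → Star Adjacent u v → u ∈ Primal.visited treeDarts → v ∈ Primal.visited treeDarts
    go ε p = p
    go ((e , refl , refl) ◅ w) p = go w (proj₂ (proj₂ tree) e tt p)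

  -- A cycle mod 2 supported on a tree vanishes at the edge of each leaf, the last dart attached.
  peel : ∀ {ds} → Primal.Grown ds → (E : Dart → Bool) → (∀ d → E (rev d) ≡ E d) → (∀ w → ∂ E w ≡ false) →
    (∀ d → edge d ∉ map edge ds → E d ≡ false) → ∀ d → E d ≡ false
  peel Growth.[] E E-rev cyc off d = off d λ ()
  peel (Growth.grow {a} {ds} _ old new g) E E-rev cyc off = peel g E E-rev cyc off′
    where
    leaf : ∀ x → x ≢ rev a → does (src x Finₚ.≟ tgt a) ∧ E x ≡ false
    leaf x x≢ with src x Finₚ.≟ tgt a
    ... | no _ = refl
    ... | yes eq = off x λ
      { (here same) → case-same (same-edge {d = x} {a} same)
      ; (there e∈) → new (subst (_∈ Primal.visited ds) eq (Primal.edge-visited g e∈)) }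
      where
      case-same : x ≡ a ⊎ x ≡ rev a → ⊥
      case-same (inj₁ refl) = new (subst (_∈ Primal.visited ds) eq old)
      case-same (inj₂ x≡) = x≢ x≡
    E-leaf : E (rev a) ≡ false
    E-leaf with ∑-single (rev a) _ leaf
    ... | eq with tgt a Finₚ.≟ tgt a
    ...   | yes _ = trans (sym eq) (cyc (tgt a))
    ...   | no ¬p = ⊥-elim (¬p refl)
    off′ : ∀ d → edge d ∉ map edge ds → E d ≡ false
    off′ d e∉ with edge d Finₚ.≟ edge a
    ... | no ≢a = off d λ { (here eq) → ≢a eq ; (there e∈) → e∉ e∈ }
    ... | yes eq with same-edge {d = d} {a} eq
    ...   | inj₁ refl = trans (sym (E-rev a)) E-leaf
    ...   | inj₂ refl = E-leaf

  OffTree : Dart → Set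
  OffTree d = edge d ∉ map edge treeDarts

  module Dual = Growth face {OffTree} (λ d → ¬? (Any.any? (edge d Finₚ.≟_) (map edge treeDarts))) (face d₀)

  cotree : ∃ λ ds → Dual.Grown ds × Dual.Closed ds
  cotree = Dual.growth

  cotreeDarts : List Dart
  cotreeDarts = proj₁ cotree

  -- The indicator `c` of the faces reached can jump only across tree edges, since the cotree is
  -- closed under off-tree darts. Its jumps form a cycle mod 2, and a cycle supported on a tree is
  -- empty, so `c` is constant and equals its value at the root.
  cotree-spans : ∀ F → F ∈ Dual.visited cotreeDarts
  cotree-spans F with face-onto F
  ... | d , refl with face d Dual.∈? Dual.visited cotreeDarts in eqd
  ...   | yes p = p
  ...   | no ¬p = ⊥-elim (contra (trans (sym (cong does eqd)) (trans (constant d d₀) (in-true (Dual.root∈visited cotreeDarts)))))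
    where
    c : Face → Bool
    c F = does (F Dual.∈? Dual.visited cotreeDarts)
    contra : false ≢ true
    contra ()
    in-true : ∀ {F} → F ∈ Dual.visited cotreeDarts → c F ≡ true
    in-true {F} p with F Dual.∈? Dual.visited cotreeDarts
    ... | yes _ = refl
    ... | no ¬p = ⊥-elim (¬p p)
    crossing : ∀ d → OffTree d → c (face d) ≡ c (face (rev d))
    crossing d off with face d Dual.∈? Dual.visited cotreeDarts | face (rev d) Dual.∈? Dual.visited cotreeDarts
    ... | yes p | yes q = refl
    ... | no p  | no q  = refl
    ... | yes p | no q  = ⊥-elim (q (proj₂ (proj₂ cotree) d off p))
    ... | no p  | yes q = ⊥-elim (p (subst (λ x → face x ∈ _) (rev′-involutive d) (proj₂ (proj₂ cotree) (rev d) off q)))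
    flips : ∀ d → c (face d) xor c (face (rev d)) ≡ false
    flips = peel (proj₁ (proj₂ tree)) _
      (flip-rev c)
      (∂-faces c) (λ d off → ≡-xor (crossing d off))
    constant : ∀ d d′ → c (face d) ≡ c (face d′)
    constant = constant-on-darts (c ∘ face)
      (λ d → trans (cong c (face-rot d)) (sym (xor-≡ (flips d)))) (λ d → sym (xor-≡ (flips d)))

  -- The tree has at least `n - 1` edges and the cotree at least `f - 1`; they are disjoint, and by
  -- Euler's formula together they are at least `m`, so no edge is left over.
  tree∪cotree : ∀ d → OffTree d → edge d ∈ map edge cotreeDarts
  tree∪cotree d off with ∈-++⁻ (map edge treeDarts) (unique-full both size (edge d))
    where
    both : Unique (map edge treeDarts ++ map edge cotreeDarts)
    both = Uniqueₚ.++⁺ (Primal.edges-unique (proj₁ (proj₂ tree))) (Dual.edges-unique (proj₁ (proj₂ cotree)))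
      (λ { (p , q) → let d , d∈ , eq = ∈-map⁻ edge q in
             All.lookup (Dual.grown-allowed (proj₁ (proj₂ cotree))) d∈ (subst (_∈ _) eq p) })
    size : m ≤ length (map edge treeDarts ++ map edge cotreeDarts)
    size = ℕₚ.+-cancelʳ-≤ 2 _ _ (subst₂ _≤_ euler count
             (ℕₚ.+-mono-≤ (Primal.spanning⇒size tree-spans) (Dual.spanning⇒size cotree-spans)))
      where
      count : suc (length treeDarts) + suc (length cotreeDarts) ≡ length (map edge treeDarts ++ map edge cotreeDarts) + 2
      count = trans (cong suc (ℕₚ.+-suc _ _)) (trans (ℕₚ.+-comm 2 _) (cong (_+ 2)
        (sym (trans (Listₚ.length-++ (map edge treeDarts)) (cong₂ _+_ (Listₚ.length-map edge treeDarts) (Listₚ.length-map edge cotreeDarts))))))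
  ... | inj₁ p = ⊥-elim (off p)
  ... | inj₂ q = q

  private
    -- The colour spreads from the root face along the cotree, switching at an attached dart `d`
    -- exactly when `E d`. This prescribes the jumps on all cotree edges.
    colour : (Dart → Bool) → List Dart → Face → Bool
    colour E []       F = false
    colour E (d ∷ ds) F = if does (F Finₚ.≟ face (rev d)) then colour E ds (face d) xor E d else colour E ds F

    colour-new : ∀ E d ds → colour E (d ∷ ds) (face (rev d)) ≡ colour E ds (face d) xor E d
    colour-new E d ds with face (rev d) Finₚ.≟ face (rev d)
    ... | yes _ = refl
    ... | no ¬p = ⊥-elim (¬p refl)

    colour-old : ∀ E d ds {F} → F ≢ face (rev d) → colour E (d ∷ ds) F ≡ colour E ds F
    colour-old E d ds {F} F≢ with F Finₚ.≟ face (rev d)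
    ... | yes p = ⊥-elim (F≢ p)
    ... | no _  = refl

    colour-flips : ∀ E {ds} → Dual.Grown ds → ∀ {d} → d ∈ ds → colour E ds (face d) xor colour E ds (face (rev d)) ≡ E d
    colour-flips E (Growth.grow {a} {ds} _ old new g) (here refl) =
      trans (cong₂ _xor_ (colour-old E a ds (λ eq → new (subst (_∈ Dual.visited ds) eq old))) (colour-new E a ds))
            (xor-cancelˡ (colour E ds (face a)) (E a))
    colour-flips E (Growth.grow {a} {ds} _ old new g) (there {d} d∈) =
      let p , q = Dual.ends-visited g d∈ in
      trans (cong₂ _xor_ (colour-old E a ds (λ eq → new (subst (_∈ Dual.visited ds) eq p)))
                         (colour-old E a ds (λ eq → new (subst (_∈ Dual.visited ds) eq q))))
            (colour-flips E g d∈)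

  -- The colouring `S` jumps as required on cotree edges. The discrepancy `R` is then a cycle mod 2
  -- supported on the tree, hence empty.
  cycle-bounds-faces : (E : Dart → Bool) → (∀ d → E (rev d) ≡ E d) → (∀ w → ∂ E w ≡ false) →
    ∃ λ (S : Face → Bool) → ∀ d → S (face d) xor S (face (rev d)) ≡ E d
  cycle-bounds-faces E E-rev cyc = S , λ d → xor-≡ (peel (proj₁ (proj₂ tree)) R R-rev R-cycle R-off d)
    where
    S : Face → Bool
    S = colour E cotreeDarts
    ∂S : Dart → Bool
    ∂S d = S (face d) xor S (face (rev d))
    ∂S-rev : ∀ d → ∂S (rev d) ≡ ∂S d
    ∂S-rev = flip-rev S
    R : Dart → Bool
    R d = ∂S d xor E d
    R-rev : ∀ d → R (rev d) ≡ R d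
    R-rev d = cong₂ _xor_ (∂S-rev d) (E-rev d)
    R-cycle : ∀ w → ∂ R w ≡ false
    R-cycle w = trans (∂-xor ∂S E w) (cong₂ _xor_ (∂-faces S w) (cyc w))
    R-off : ∀ d → OffTree d → R d ≡ false
    R-off d off with ∈-map⁻ edge (tree∪cotree d off)
    ... | a , a∈ , eq with same-edge {d = d} {a} eq
    ...   | inj₁ refl = ≡-xor (colour-flips E (proj₁ (proj₂ cotree)) a∈)
    ...   | inj₂ refl = ≡-xor (trans (∂S-rev a) (trans (colour-flips E (proj₁ (proj₂ cotree)) a∈) (sym (E-rev a))))

-- The cycle Z and its two sides

nth : {A : Set} → A → List A → ℕ → A
nth x []       _       = x
nth x (y ∷ ys) zero    = y
nth x (y ∷ ys) (suc i) = nth x ys i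

module _ {A : Set} {x : A} where
  nth-∈ : ∀ {xs i} → i < length xs → nth x xs i ∈ xs
  nth-∈ {_ ∷ _} {zero}  _       = here refl
  nth-∈ {_ ∷ _} {suc i} (s≤s p) = there (nth-∈ p)

  ∈-nth : ∀ {xs y} → y ∈ xs → ∃ λ i → i < length xs × nth x xs i ≡ y
  ∈-nth (here refl) = 0 , s≤s z≤n , refl
  ∈-nth (there y∈)  = let i , p , eq = ∈-nth y∈ in suc i , s≤s p , eq

  nth-length : ∀ xs → nth x xs (length xs) ≡ x
  nth-length []       = refl
  nth-length (_ ∷ xs) = nth-length xs

  nth-linked : ∀ {R : A → A → Set} {xs} → Linked R (xs ∷ʳ x) → ∀ {i} → i < length xs → R (nth x xs i) (nth x xs (suc i))
  nth-linked {xs = _ ∷ []}     (r ∷ _)  {zero}  _       = r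
  nth-linked {xs = _ ∷ _ ∷ _}  (r ∷ _)  {zero}  _       = r
  nth-linked {xs = _ ∷ []}     (_ ∷ _)  {suc i} (s≤s ())
  nth-linked {xs = _ ∷ y ∷ xs} (_ ∷ rs) {suc i} (s≤s p) = nth-linked {xs = y ∷ xs} rs p

  nth-injective : ∀ {B : Set} {g : A → B} {xs} → Unique (map g xs) → ∀ {i j} → i < length xs → j < length xs →
    g (nth x xs i) ≡ g (nth x xs j) → i ≡ j
  nth-injective {xs = _ ∷ _} _        {zero}  {zero}  _ _ _ = refl
  nth-injective {g = g} {_ ∷ _} (new ∷ _) {zero}  {suc j} _ (s≤s q) eq = ⊥-elim (All.lookup new (∈-map⁺ g (nth-∈ q)) eq)
  nth-injective {g = g} {_ ∷ _} (new ∷ _) {suc i} {zero}  (s≤s p) _ eq = ⊥-elim (All.lookup new (∈-map⁺ g (nth-∈ p)) (sym eq))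
  nth-injective {xs = _ ∷ _} (_ ∷ u)  {suc i} {suc j} (s≤s p) (s≤s q) eq = cong suc (nth-injective u p q eq)

≢⇒not : ∀ {a b} → a ≢ b → b ≡ not a
≢⇒not {false} {false} p = ⊥-elim (p refl)
≢⇒not {false} {true}  _ = refl
≢⇒not {true}  {false} _ = refl
≢⇒not {true}  {true}  p = ⊥-elim (p refl)

not-fixed : ∀ {a b : Bool} → a ≡ b → a ≡ not b → ⊥
not-fixed {true} {true} _ ()
not-fixed {false} {false} _ ()

module Disc {G : Graph} (connected : Graph.Connected G) (emb : SphereEmbedding G) (Z : Cycle G)
  (D : Subset (SphereEmbedding.f emb)) (disc : SphereEmbedding.IsDiscBoundedBy emb Z D) where
  open Graph G
  open SphereEmbedding emb
  open Sphere connected emb (Cycle.first Z) public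

  ℓ : ℕ
  ℓ = length (Cycle.darts Z)

  -- Beyond the list `nth` returns its default, here the first dart, so `z ℓ` is `z 0` and the step
  -- from `i` to `suc i` with `i < ℓ` covers the closing step of the cycle too.
  z : ℕ → Dart
  z = nth (Cycle.first Z) (Cycle.darts Z)

  OnZ : Dart → Set
  OnZ d = edge d ∈ Cycle.edges Z

  inD : Dart → Bool
  inD d = Vec.lookup D (face d)

  inD-φ : ∀ d → inD (φ d) ≡ inD d
  inD-φ d = cong (Vec.lookup D) (face-φ d)

  inD-rot : ∀ d → inD (rot d) ≡ inD (rev d)
  inD-rot d = cong (Vec.lookup D) (face-rot d)

  onZ? : ∀ d → Dec (OnZ d)
  onZ? d = Any.any? (edge d Finₚ.≟_) (Cycle.edges Z)

  inD-on : ∀ d → OnZ d → inD (rev d) ≡ not (inD d)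
  inD-on d on = ≢⇒not (Equivalence.to (disc d) on)

  inD-off : ∀ d → ¬ OnZ d → inD (rev d) ≡ inD d
  inD-off d off with inD (rev d) 𝔹.≟ inD d
  ... | yes eq = eq
  ... | no ≢ = ⊥-elim (off (Equivalence.from (disc d) (λ eq → ≢ (sym eq))))

  z-link : ∀ {i} → i < ℓ → tgt (z i) ≡ src (z (suc i))
  z-link = nth-linked (Cycle.closed Z)

  z-injective : ∀ {i j} → i < ℓ → j < ℓ → src (z i) ≡ src (z j) → i ≡ j
  z-injective = nth-injective (Cycle.distinct Z)

  z-wrap : z ℓ ≡ z 0
  z-wrap = nth-length (Cycle.rest Z)

  z-normal : ∀ {i} → i ≤ ℓ → ∃ λ j → j < ℓ × z j ≡ z i
  z-normal {i} i≤ with ℕₚ.m≤n⇒m<n∨m≡n i≤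
  ... | inj₁ i<   = i , i< , refl
  ... | inj₂ refl = 0 , s≤s z≤n , sym z-wrap

  z-on : ∀ {i} → i ≤ ℓ → OnZ (z i)
  z-on i≤ = let j , j< , eq = z-normal i≤ in subst OnZ eq (∈-map⁺ edge (nth-∈ j<))

  z-src-injective : ∀ {i j} → i ≤ ℓ → j ≤ ℓ → src (z i) ≡ src (z j) → z i ≡ z j
  z-src-injective i≤ j≤ eq with z-normal i≤ | z-normal j≤
  ... | i′ , i′< , eqi | j′ , j′< , eqj = trans (sym eqi)
    (trans (cong z (z-injective i′< j′< (trans (cong src eqi) (trans eq (cong src (sym eqj)))))) eqj)

  z-tgt-injective : ∀ {i j} → i < ℓ → j < ℓ → tgt (z i) ≡ tgt (z j) → i ≡ j
  z-tgt-injective {i} {j} i< j< eq with ℕₚ.m≤n⇒m<n∨m≡n i< | ℕₚ.m≤n⇒m<n∨m≡n j<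
  ... | inj₂ refl | inj₂ refl = refl
  ... | inj₁ p | inj₁ q = ℕₚ.suc-injective (z-injective p q (trans (sym (z-link i<)) (trans eq (z-link j<))))
  ... | inj₁ p | inj₂ refl with z-injective p (s≤s z≤n) (trans (sym (z-link i<)) (trans eq (trans (z-link j<) (cong src z-wrap))))
  ...   | ()
  z-tgt-injective {i} {j} i< j< eq | inj₂ refl | inj₁ q with z-injective q (s≤s z≤n) (trans (sym (z-link j<)) (trans (sym eq) (trans (z-link i<) (cong src z-wrap))))
  ...   | ()

  on⇒z : ∀ d → OnZ d → ∃ λ i → i < ℓ × (d ≡ z i ⊎ d ≡ rev (z i))
  on⇒z d on with ∈-map⁻ edge on
  ... | a , a∈ , eq with ∈-nth {x = Cycle.first Z} a∈
  ...   | i , i< , refl = i , i< , same-edge {d = d} {z i} eq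

  ∈Z⇒z : ∀ {v} → v ∈ Cycle.vertices Z → ∃ λ i → i < ℓ × src (z i) ≡ v
  ∈Z⇒z v∈ with ∈-map⁻ src v∈
  ... | a , a∈ , refl with ∈-nth {x = Cycle.first Z} a∈
  ...   | i , i< , refl = i , i< , refl

  z∈Z : ∀ {i} → i ≤ ℓ → src (z i) ∈ Cycle.vertices Z
  z∈Z i≤ = let j , j< , eq = z-normal i≤ in subst (λ d → src d ∈ _) eq (∈-map⁺ src (nth-∈ j<))

  on⇒src∈Z : ∀ d → OnZ d → src d ∈ Cycle.vertices Z
  on⇒src∈Z d on with on⇒z d on
  ... | i , i< , inj₁ refl = z∈Z (ℕₚ.<⇒≤ i<)
  ... | i , i< , inj₂ refl = subst (_∈ Cycle.vertices Z) (sym (z-link i<)) (z∈Z i<)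

  on-at : ∀ {i} d → i < ℓ → src d ≡ src (z (suc i)) → OnZ d → d ≡ z (suc i) ⊎ d ≡ rev (z i)
  on-at {i} d i< eq on with on⇒z d on
  ... | j , j< , inj₁ refl = inj₁ (z-src-injective (ℕₚ.<⇒≤ j<) i< eq)
  ... | j , j< , inj₂ refl = inj₂ (cong (rev ∘ z) (z-tgt-injective j< i< (trans eq (sym (z-link i<)))))

  -- The property is carried from `a` towards `b` by turning around their vertex; the turn either
  -- arrives or is stopped at `p` or `q`.
  rotate : (Pr : Dart → Set) (p q : Dart) → (∀ d → Pr d → d ≢ p → d ≢ q → Pr (rot d)) →
    ∀ {a b} → src a ≡ src b → Pr a → Pr b ⊎ (Pr p ⊎ Pr q)
  rotate Pr p q step {a} {b} eq pa with Equivalence.to (vertex-orbit a b) eq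
  ... | k , refl = go k
    where
    go : ∀ k → Pr (fold a rot k) ⊎ (Pr p ⊎ Pr q)
    go zero = inj₁ pa
    go (suc k) with go k
    ... | inj₂ r = inj₂ r
    ... | inj₁ r with fold a rot k ≟ᵈ p | fold a rot k ≟ᵈ q
    ...   | yes refl | _        = inj₂ (inj₁ r)
    ...   | _        | yes refl = inj₂ (inj₂ r)
    ...   | no ≢p    | no ≢q    = inj₁ (step _ r ≢p ≢q)

  module AtZ {i} (i< : i < ℓ) (g : Dart → Bool) (β : Bool)
    (g-φ : ∀ d → inD d ≡ β → g (φ d) ≡ g d)
    (g-rev : ∀ d → src d ≡ src (z (suc i)) → inD d ≡ β → ¬ OnZ d → g (rev d) ≡ g d) where

    -- A step of the turn crosses one edge, and only edges of `Z` separate the sides. So the turn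
    -- stays on side `β`, and keeps the value of `g`, until it stands before one of the two darts of
    -- `Z` at this vertex.
    exit : ∀ a → src a ≡ src (z (suc i)) → inD a ≡ β →
      (inD (z (suc i)) ≡ β × g (z (suc i)) ≡ g a) ⊎ (inD (rev (z i)) ≡ β × g (rev (z i)) ≡ g a)
    exit a src-a in-a with rotate Pr (z (suc i)) (rev (z i)) step {b = z (suc i)} src-a (src-a , in-a , refl)
      where
      Pr : Dart → Set
      Pr d = src d ≡ src (z (suc i)) × inD d ≡ β × g d ≡ g a
      step : ∀ d → Pr d → d ≢ z (suc i) → d ≢ rev (z i) → Pr (rot d)
      step d (at , ind , same) ≢p ≢q = trans (src-rot d) at , trans (inD-rot d) in-rev
                                     , trans (cong g (sym (φ-rev d))) (trans (g-φ (rev d) in-rev) (trans (g-rev d at ind off) same))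
        where
        off : ¬ OnZ d
        off on with on-at d i< at on
        ... | inj₁ eq = ≢p eq
        ... | inj₂ eq = ≢q eq
        in-rev : inD (rev d) ≡ β
        in-rev = trans (inD-off d off) ind
    ... | inj₁ (_ , r) = inj₁ r
    ... | inj₂ (inj₁ (_ , r)) = inj₁ r
    ... | inj₂ (inj₂ (_ , r)) = inj₂ r

    forward : inD (z i) ≡ β → inD (z (suc i)) ≡ β × g (z (suc i)) ≡ g (z i)
    forward in-z with exit (φ (z i)) (trans (src-φ (z i)) (z-link i<)) (trans (inD-φ (z i)) in-z)
    ... | inj₁ (p , q) = p , trans q (g-φ _ in-z)
    ... | inj₂ (p , _) = ⊥-elim (not-fixed p (trans (inD-on _ (z-on (ℕₚ.<⇒≤ i<))) (cong not in-z)))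

    backward : inD (rev (z (suc i))) ≡ β → inD (rev (z i)) ≡ β × g (rev (z i)) ≡ g (rev (z (suc i)))
    backward in-z with exit (φ (rev (z (suc i)))) (trans (src-φ _) (tgt-rev _)) (trans (inD-φ _) in-z)
    ... | inj₂ (p , q) = p , trans q (g-φ _ in-z)
    ... | inj₁ (p , _) = ⊥-elim (not-fixed (sym in-z) (trans (sym p) (trans (sym (𝔹.not-involutive _)) (cong not (sym (inD-on _ (z-on i<)))))))

  β₀ : Bool
  β₀ = inD (z 0)

  oriented : ∀ i → i ≤ ℓ → inD (z i) ≡ β₀
  oriented zero    _  = refl
  oriented (suc i) i< = proj₁ (AtZ.forward i< (λ _ → true) β₀ (λ _ _ → refl) (λ _ _ _ _ → refl) (oriented i (ℕₚ.<⇒≤ i<)))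

  -- The i-th edge of Z, directed so that the disc (β = true) or its complement (β = false) lies on its left.
  side : Bool → ℕ → Dart
  side β i = if β xor β₀ then rev (z i) else z i

  xor-true : ∀ a b → a xor b ≡ true → a ≡ not b
  xor-true false true _ = refl
  xor-true true false _ = refl

  inD-side : ∀ β {i} → i ≤ ℓ → inD (side β i) ≡ β
  inD-side β {i} i≤ with β xor β₀ in eq
  ... | false = trans (oriented i i≤) (sym (xor-≡ eq))
  ... | true  = trans (inD-on _ (z-on i≤)) (trans (cong not (oriented i i≤)) (sym (xor-true β β₀ eq)))

  -- Consecutive edges of `Z` see side `β` through the consecutive corners at their common vertex,
  -- so `AtZ` carries `g` from one edge to the next.
  side-constant : ∀ β (g : Dart → Bool) → (∀ d → inD d ≡ β → g (φ d) ≡ g d) →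
    (∀ d → inD d ≡ β → ¬ OnZ d → g (rev d) ≡ g d) → ∀ {i j} → i ≤ ℓ → j ≤ ℓ → g (side β i) ≡ g (side β j)
  side-constant β g g-φ g-rev i≤ j≤ = trans (to-zero _ i≤) (sym (to-zero _ j≤))
    where
    step : ∀ {i} → i < ℓ → g (side β (suc i)) ≡ g (side β i)
    step {i} i< with β xor β₀ | inD-side β (ℕₚ.<⇒≤ i<) | inD-side β i<
    ... | false | p | _ = proj₂ (AtZ.forward i< g β g-φ (λ d _ → g-rev d) p)
    ... | true  | _ | q = sym (proj₂ (AtZ.backward i< g β g-φ (λ d _ → g-rev d) q))
    to-zero : ∀ i → i ≤ ℓ → g (side β i) ≡ g (side β 0)
    to-zero zero    _  = refl
    to-zero (suc i) i< = trans (step i<) (to-zero i (ℕₚ.<⇒≤ i<))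

  -- The corners at v in the disc, or in its complement, are consecutive around v.
  corners-constant : ∀ β (g : Dart → Bool) v → (∀ d → inD d ≡ β → g (φ d) ≡ g d) →
    (∀ d → src d ≡ v → inD d ≡ β → ¬ OnZ d → g (rev d) ≡ g d) →
    ∀ {a b} → src a ≡ v → src b ≡ v → inD a ≡ β → inD b ≡ β → g a ≡ g b
  corners-constant β g v g-φ g-rev {a} {b} at-a at-b in-a in-b with Any.any? (v Finₚ.≟_) (Cycle.vertices Z)
  ... | yes v∈ = on-cycle (∈Z⇒suc v∈)
    where
    -- `AtZ` speaks of `z (suc i)`, so the vertex of index 0 is taken as the one of index `ℓ`.
    ∈Z⇒suc : v ∈ Cycle.vertices Z → ∃ λ i → i < ℓ × src (z (suc i)) ≡ v
    ∈Z⇒suc v∈ with ∈Z⇒z v∈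
    ... | zero  , _  , eq = length (Cycle.rest Z) , ℕₚ.≤-refl , trans (cong src z-wrap) eq
    ... | suc i , i< , eq = i , ℕₚ.<⇒≤ i< , eq
    on-cycle : _ → g a ≡ g b
    on-cycle (i , i< , refl) with AtZ.exit i< g β g-φ g-rev a at-a in-a | AtZ.exit i< g β g-φ g-rev b at-b in-b
    ... | inj₁ (_ , p) | inj₁ (_ , q) = trans (sym p) q
    ... | inj₂ (_ , p) | inj₂ (_ , q) = trans (sym p) q
    ... | inj₁ (p , _) | inj₂ (q , _) = ⊥-elim (not-fixed (trans q (sym p)) (trans (inD-on _ (z-on (ℕₚ.<⇒≤ i<))) (cong not (trans (oriented i (ℕₚ.<⇒≤ i<)) (sym (oriented (suc i) i<))))))
    ... | inj₂ (q , _) | inj₁ (p , _) = ⊥-elim (not-fixed (trans q (sym p)) (trans (inD-on _ (z-on (ℕₚ.<⇒≤ i<))) (cong not (trans (oriented i (ℕₚ.<⇒≤ i<)) (sym (oriented (suc i) i<))))))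
  ... | no v∉ with rotate Pr b b step {b = b} (trans at-a (sym at-b)) (at-a , in-a , refl)
    where
    Pr : Dart → Set
    Pr d = src d ≡ v × inD d ≡ β × g d ≡ g a
    step : ∀ d → Pr d → d ≢ b → d ≢ b → Pr (rot d)
    step d (at , ind , same) _ _ = trans (src-rot d) at , trans (inD-rot d) in-rev
                                 , trans (cong g (sym (φ-rev d))) (trans (g-φ (rev d) in-rev) (trans (g-rev d at ind off) same))
      where
      off : ¬ OnZ d
      off on = v∉ (subst (_∈ Cycle.vertices Z) at (on⇒src∈Z d on))
      in-rev : inD (rev d) ≡ β
      in-rev = trans (inD-off d off) ind
  ...   | inj₁ (_ , _ , r) = sym r
  ...   | inj₂ (inj₁ (_ , _ , r)) = sym r
  ...   | inj₂ (inj₂ (_ , _ , r)) = sym r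

  -- Away from `Z` a turn around the vertex never changes sides, so one corner outside the disc puts
  -- all of them outside.
  outside : ∀ {v} b → src b ≡ v → inD b ≡ false → v ∈ Cycle.vertices Z ⊎ ¬ VertexInDisc D v
  outside {v} b at-b out-b with Any.any? (v Finₚ.≟_) (Cycle.vertices Z)
  ... | yes v∈ = inj₁ v∈
  ... | no v∉ = inj₂ λ { (a , at-a , in-a) →
    contra (Vecₚ.[]=⇒lookup in-a) (rotate Pr a a step {b = a} (trans at-b (sym at-a)) (at-b , out-b)) }
    where
    Pr : Dart → Set
    Pr d = src d ≡ v × inD d ≡ false
    step : ∀ {a} d → Pr d → d ≢ a → d ≢ a → Pr (rot d)
    step d (at , out) _ _ = trans (src-rot d) at
      , trans (inD-rot d) (trans (inD-off d (λ on → v∉ (subst (_∈ Cycle.vertices Z) at (on⇒src∈Z d on)))) out)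
    contra : ∀ {a} → inD a ≡ true → Pr a ⊎ (Pr a ⊎ Pr a) → ⊥
    contra in-a (inj₁ (_ , out))        = not-fixed in-a out
    contra in-a (inj₂ (inj₁ (_ , out))) = not-fixed in-a out
    contra in-a (inj₂ (inj₂ (_ , out))) = not-fixed in-a out

-- Colourings defined by closed curves

xor-true⇒≢ : ∀ {a b} → a xor b ≡ true → a ≢ b
xor-true⇒≢ {true} {true} () _
xor-true⇒≢ {false} {false} () _

xor-cancel-≡ : ∀ {a b c d} → a xor b ≡ c xor d → a ≡ c → b ≡ d
xor-cancel-≡ {false} eq refl = eq
xor-cancel-≡ {true}  eq refl = 𝔹.not-injective eq

module Colouring {G : Graph} (connected : Graph.Connected G) (emb : SphereEmbedding G) (Z : Cycle G)
  (D : Subset (SphereEmbedding.f emb)) (disc : SphereEmbedding.IsDiscBoundedBy emb Z D) where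
  open Graph G
  open SphereEmbedding emb
  open Disc connected emb Z D disc public

  is : Vertex → Vertex → Bool
  is u w = does (u Finₚ.≟ w)

  mark spot : Dart → Dart → Bool
  mark a d = does (edge d Finₚ.≟ edge a)
  spot a d = does (d ≟ᵈ a)

  mark-false : ∀ a d → edge d ≢ edge a → mark a d ≡ false
  mark-false a d ≢ with edge d Finₚ.≟ edge a
  ... | yes eq = ⊥-elim (≢ eq)
  ... | no _   = refl

  mark-true : ∀ a → mark a a ≡ true
  mark-true a with edge a Finₚ.≟ edge a
  ... | yes _ = refl
  ... | no ≢  = ⊥-elim (≢ refl)

  spot-false : ∀ {a d} → d ≢ a → spot a d ≡ false
  spot-false {a} {d} ≢ with d ≟ᵈ a
  ... | yes eq = ⊥-elim (≢ eq)
  ... | no _   = refl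

  spot-true : ∀ a → spot a a ≡ true
  spot-true a with a ≟ᵈ a
  ... | yes _ = refl
  ... | no ≢  = ⊥-elim (≢ refl)

  rev-≢ : ∀ d → rev d ≢ d
  rev-≢ (e , true) ()
  rev-≢ (e , false) ()

  spot-mark : ∀ a d → spot a d xor spot a (rev d) ≡ mark a d
  spot-mark a d with edge d Finₚ.≟ edge a
  ... | no ≢ = cong₂ _xor_ (spot-false (λ eq → ≢ (cong edge eq))) (spot-false (λ eq → ≢ (cong edge eq)))
  ... | yes eq with same-edge {d = d} {a} eq
  ...   | inj₁ refl = cong₂ _xor_ (spot-true a) (spot-false (rev-≢ a))
  ...   | inj₂ refl = cong₂ _xor_ (spot-false (rev-≢ a)) (trans (cong (spot a) (rev′-involutive a)) (spot-true a))

  ∂-mark : ∀ a w → ∂ (mark a) w ≡ is (src a) w xor is (tgt a) w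
  ∂-mark a w = trans (∑-cong (λ d → cong (is (src d) w ∧_) (sym (spot-mark a d))))
    (trans (∂-xor (spot a) (spot a ∘ rev) w) (cong₂ _xor_ at-src at-tgt))
    where
    at-src : ∂ (spot a) w ≡ is (src a) w
    at-src = trans (∑-single a _ (λ x ≢ → trans (cong (is (src x) w ∧_) (spot-false ≢)) (𝔹.∧-zeroʳ _)))
      (trans (cong (is (src a) w ∧_) (spot-true a)) (𝔹.∧-identityʳ _))
    at-tgt : ∂ (spot a ∘ rev) w ≡ is (tgt a) w
    at-tgt = trans (∑-single (rev a) _ (λ x ≢ → trans (cong (is (src x) w ∧_)
        (spot-false (λ eq → ≢ (trans (sym (rev′-involutive x)) (cong rev eq))))) (𝔹.∧-zeroʳ _)))
      (trans (cong (is (tgt a) w ∧_) (trans (cong (spot a) (rev′-involutive a)) (spot-true a))) (𝔹.∧-identityʳ _))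

  record Chain (u v : Vertex) (E : Dart → Bool) : Set where
    field
      symmetric : ∀ d → E (rev d) ≡ E d
      boundary  : ∀ w → ∂ E w ≡ is u w xor is v w

  trivial : ∀ {u} → Chain u u (λ _ → false)
  trivial {u} = record
    { symmetric = λ _ → refl
    ; boundary  = λ w → trans (∑-false (λ d → 𝔹.∧-zeroʳ (is (src d) w))) (sym (𝔹.xor-same (is u w))) }

  join : ∀ {u v w E F} → Chain u v E → Chain v w F → Chain u w (λ d → E d xor F d)
  join {u} {v} {w} {E} {F} c c′ = record
    { symmetric = λ d → cong₂ _xor_ (symmetric c d) (symmetric c′ d)
    ; boundary  = λ x → trans (∂-xor E F x) (trans (cong₂ _xor_ (boundary c x) (boundary c′ x))
        (trans (𝔹.xor-assoc (is u x) _ _) (cong (is u x xor_) (xor-cancelˡ (is v x) _)))) }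
    where open Chain

  dart-chain : ∀ a → Chain (src a) (tgt a) (mark a)
  dart-chain a = record { symmetric = λ _ → refl ; boundary = ∂-mark a }

  closed-chain-bounds : ∀ {u v E F} → Chain u v E → Chain u v F →
    ∃ λ (S : Face → Bool) → ∀ d → S (face d) xor S (face (rev d)) ≡ E d xor F d
  closed-chain-bounds {E = E} {F} c c′ = cycle-bounds-faces _
    (λ d → cong₂ _xor_ (symmetric c d) (symmetric c′ d))
    (λ w → trans (∂-xor E F w) (≡-xor (trans (boundary c w) (sym (boundary c′ w)))))
    where open Chain

  -- Given by start and length: `suc k + i` reduces, so the arc and its chain are built by recursion
  -- on `k`.
  Arc : ℕ → ℕ → Dart → Bool
  Arc i zero    d = false
  Arc i (suc k) d = Arc i k d xor mark (z (k + i)) d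

  arc-chain : ∀ i k → k + i ≤ ℓ → Chain (src (z i)) (src (z (k + i))) (Arc i k)
  arc-chain i zero    _ = trivial
  arc-chain i (suc k) p = subst (λ v → Chain (src (z i)) v (Arc i (suc k))) (z-link p)
    (join (arc-chain i k (ℕₚ.<⇒≤ p)) (dart-chain (z (k + i))))

  z-edge-injective : ∀ {i j} → i < ℓ → j < ℓ → edge (z i) ≡ edge (z j) → i ≡ j
  z-edge-injective {i} {j} i< j< eq with same-edge {d = z i} {z j} eq
  ... | inj₁ same = z-injective i< j< (cong src same)
  -- All `z i` have the disc on the same side, whereas a dart of `Z` and its reverse have it on
  -- opposite sides.
  ... | inj₂ opp  = ⊥-elim (not-fixed (sym (trans (cong inD (sym opp)) (oriented i (ℕₚ.<⇒≤ i<))))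
                      (trans (sym (oriented j (ℕₚ.<⇒≤ j<))) (trans (sym (𝔹.not-involutive _)) (cong not (sym (inD-on _ (z-on (ℕₚ.<⇒≤ j<))))))))

  arc-outside : ∀ i k p → k + i ≤ ℓ → p < ℓ → p < i ⊎ k + i ≤ p → Arc i k (z p) ≡ false
  arc-outside i zero p _ _ _ = refl
  arc-outside i (suc k) p k< p< out = cong₂ _xor_
    (arc-outside i k p (ℕₚ.<⇒≤ k<) p< (Sum.map₂ ℕₚ.<⇒≤ out))
    (mark-false (z (k + i)) (z p) (λ eq → apart out (z-edge-injective p< k< eq)))
    where
    apart : p < i ⊎ suc (k + i) ≤ p → p ≢ k + i
    apart (inj₁ lt) refl = ℕₚ.<⇒≱ lt (ℕₚ.m≤n+m i k)
    apart (inj₂ lt) refl = ℕₚ.<-irrefl refl lt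

  arc-inside : ∀ i k p → k + i ≤ ℓ → i ≤ p → p < k + i → Arc i k (z p) ≡ true
  arc-inside i zero p _ i≤ p< = ⊥-elim (ℕₚ.<⇒≱ p< i≤)
  arc-inside i (suc k) p k< i≤ p< with p ℕₚ.≟ k + i
  ... | yes refl = cong₂ _xor_ (arc-outside i k (k + i) (ℕₚ.<⇒≤ k<) k< (inj₂ ℕₚ.≤-refl)) (mark-true (z p))
  ... | no ≢ = cong₂ _xor_ (arc-inside i k p (ℕₚ.<⇒≤ k<) i≤ (ℕₚ.≤∧≢⇒< (s≤s⁻¹ p<) ≢))
                 (mark-false (z (k + i)) (z p) (λ eq → ≢ (z-edge-injective (ℕₚ.<-≤-trans p< k<) k< eq)))

  arc-off : ∀ i k → k + i ≤ ℓ → ∀ d → ¬ OnZ d → Arc i k d ≡ false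
  arc-off i zero    _  d off = refl
  arc-off i (suc k) k< d off = cong₂ _xor_ (arc-off i k (ℕₚ.<⇒≤ k<) d off)
    (mark-false (z (k + i)) d (λ eq → off (subst (_∈ Cycle.edges Z) (sym eq) (z-on (ℕₚ.<⇒≤ k<)))))

  AdjIn : (Vertex → Set) → Vertex → Vertex → Set
  AdjIn P u v = ∃ λ d → src d ≡ u × tgt d ≡ v × P u × P v

  path-chain : ∀ {P u v} → Star (AdjIn P) u v → ∃ λ E → Chain u v E × (∀ d → ¬ P (src d) → E d ≡ false)
  path-chain ε = _ , trivial , λ _ _ → refl
  path-chain ((a , refl , refl , pu , pv) ◅ w) =
    let E , c , off = path-chain w in
    _ , join (dart-chain a) c , λ d ¬p → cong₂ _xor_ (mark-false a d (avoid d ¬p)) (off d ¬p)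
    where
    avoid : ∀ d → ¬ _ → edge d ≢ edge a
    avoid d ¬p eq with same-edge {d = d} {a} eq
    ... | inj₁ refl = ¬p pu
    ... | inj₂ refl = ¬p pv

  record ChordIn (vs : List Vertex) (β : Bool) (u v : Vertex) : Set where
    field
      chord : Chord u v
      start : u ∈ vs
      end   : v ∈ vs
      on    : inD (Chord.out chord) ≡ β

  -- Both follow the facial walk from `a` mod 2. An edge that the walk traverses in both directions
  -- cancels in `facial` but leaves its two darts in `facialDarts`.
  facial facialDarts : Dart → ℕ → Dart → Bool
  facial a zero    d = false
  facial a (suc k) d = facial a k d xor mark (fold a φ k) d
  facialDarts a zero    d = false
  facialDarts a (suc k) d = facialDarts a k d xor spot (fold a φ k) d

  facial-chain : ∀ a k → Chain (src a) (src (fold a φ k)) (facial a k)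
  facial-chain a zero    = trivial
  facial-chain a (suc k) = subst (λ v → Chain (src a) v (facial a (suc k))) (sym (src-φ (fold a φ k)))
    (join (facial-chain a k) (dart-chain (fold a φ k)))

  facialDarts-rev : ∀ a k d → facialDarts a k d xor facialDarts a k (rev d) ≡ facial a k d
  facialDarts-rev a zero    d = refl
  facialDarts-rev a (suc k) d = trans (xor-interchange (facialDarts a k d) _ _ _)
    (cong₂ _xor_ (facialDarts-rev a k d) (spot-mark (fold a φ k) d))

  φ-injective : ∀ {a b} → φ a ≡ φ b → a ≡ b
  φ-injective {a} {b} eq = trans (sym (Inverse.strictlyInverseʳ φ↔ a)) (trans (cong (Inverse.from φ↔) eq) (Inverse.strictlyInverseʳ φ↔ b))

  spot-φ : ∀ a d → spot (φ a) (φ d) ≡ spot a d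
  spot-φ a d with d ≟ᵈ a
  ... | yes refl = spot-true (φ a)
  ... | no ≢     = spot-false (λ eq → ≢ (φ-injective eq))

  -- Shifting the walk by `φ` telescopes; only its first dart and the dart after its last one
  -- remain.
  facialDarts-φ : ∀ a k d → facialDarts a k d xor facialDarts a k (φ d) ≡ spot a (φ d) xor spot (fold a φ k) (φ d)
  facialDarts-φ a zero    d = sym (𝔹.xor-same (spot a (φ d)))
  facialDarts-φ a (suc k) d = trans (xor-interchange (facialDarts a k d) _ _ _)
    (trans (cong₂ _xor_ (facialDarts-φ a k d) refl) (trans (shuffle (spot a (φ d)) (spot (fold a φ k) (φ d)) _)
      (cong (spot a (φ d) xor_) (sym (spot-φ (fold a φ k) d)))))
    where
    shuffle : ∀ x y w → (x xor y) xor (w xor y) ≡ x xor w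
    shuffle x y w = trans (xor-interchange x y w y) (trans (cong ((x xor w) xor_) (𝔹.xor-same y)) (𝔹.xor-identityʳ _))

  -- `T` colours darts, that is, sides of edges. Across edges it jumps along `E`; within a face it
  -- can jump only at corners on side `β` of vertices in `vs`, where the normal curve enters or
  -- leaves the face.
  record DualChain (vs : List Vertex) (β : Bool) (u v : Vertex) : Set where
    field
      E T     : Dart → Bool
      chain   : Chain u v E
      T-rev   : ∀ d → T d xor T (rev d) ≡ E d
      T-side  : ∀ d → inD d ≢ β → T (φ d) ≡ T d
      T-avoid : ∀ d → src (φ d) ∉ vs → T (φ d) ≡ T d

  -- A chord is homologous to the facial walk between its ends; T records the faces' corners in between.
  chord-chain : ∀ {vs β u v} → ChordIn vs β u v → DualChain vs β u v
  chord-chain {vs} {β} {u} {v} c = from (Equivalence.to (face-orbit out into) same-face)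
    where
    open ChordIn c
    open Chord chord
    from : SameOrbit φ out into → DualChain vs β u v
    from (k , eq) = record
      { E = facial out k ; T = facialDarts out k
      ; chain = subst₂ (λ u v → Chain u v (facial out k)) out-at (trans (cong src eq) into-at) (facial-chain out k)
      ; T-rev = facialDarts-rev out k
      ; T-side = λ d ≢β → unmoved d (λ e → ≢β (trans (sym (inD-φ d)) (trans (cong inD e) on)))
                                     (λ e → ≢β (trans (sym (inD-φ d)) (trans (cong inD e) (trans (cong (Vec.lookup D) (sym same-face)) on))))
      ; T-avoid = λ d ∉vs → unmoved d (λ e → ∉vs (subst (_∈ vs) (sym (trans (cong src e) out-at)) start))
                                       (λ e → ∉vs (subst (_∈ vs) (sym (trans (cong src e) into-at)) end))
      }
      where
      unmoved : ∀ d → φ d ≢ out → φ d ≢ into → facialDarts out k (φ d) ≡ facialDarts out k d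
      unmoved d ≢out ≢into = sym (xor-≡ (trans (facialDarts-φ out k d)
        (cong₂ _xor_ (spot-false ≢out) (spot-false (λ e → ≢into (trans e eq))))))

  curve-chain : ∀ {vs β u v} → Star (ChordIn vs β) u v → DualChain vs β u v
  curve-chain ε = record { E = λ _ → false ; T = λ _ → false ; chain = trivial ; T-rev = λ _ → refl
                         ; T-side = λ _ _ → refl ; T-avoid = λ _ _ → refl }
  curve-chain (c ◅ γ) = record
    { E = λ d → Head.E d xor Tail.E d ; T = λ d → Head.T d xor Tail.T d
    ; chain = join Head.chain Tail.chain
    ; T-rev = λ d → trans (xor-interchange (Head.T d) _ _ _) (cong₂ _xor_ (Head.T-rev d) (Tail.T-rev d))
    ; T-side = λ d p → cong₂ _xor_ (Head.T-side d p) (Tail.T-side d p)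
    ; T-avoid = λ d p → cong₂ _xor_ (Head.T-avoid d p) (Tail.T-avoid d p) }
    where
    module Head = DualChain (chord-chain c)
    module Tail = DualChain (curve-chain γ)

  -- `U` colours the two sides of the closed curve made of the normal curve and the arc. Adding a
  -- face colouring `S` that bounds `E` plus the arc cancels the facial walks: across edges only the
  -- arc remains, and within faces only the jumps at the curve.
  curve-colouring : ∀ {vs β} i k → k + i ≤ ℓ → Star (ChordIn vs β) (src (z i)) (src (z (k + i))) →
    ∃ λ (U : Dart → Bool) → (∀ d → U d xor U (rev d) ≡ Arc i k d)
      × (∀ d → inD d ≢ β → U (φ d) ≡ U d) × (∀ d → src (φ d) ∉ vs → U (φ d) ≡ U d)
  curve-colouring i k k≤ γ =
    let S , flips = closed-chain-bounds chain (arc-chain i k k≤) in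
    (λ d → T d xor S (face d))
    , (λ d → trans (xor-interchange (T d) _ _ _) (trans (cong₂ _xor_ (T-rev d) (flips d)) (xor-cancelˡ (E d) _)))
    , (λ d p → cong₂ _xor_ (T-side d p) (cong S (face-φ d)))
    , (λ d p → cong₂ _xor_ (T-avoid d p) (cong S (face-φ d)))
    where open DualChain (curve-chain γ)

  -- Here path and arc both consist of edges, so the closed curve is coloured by whole faces.
  path-colouring : ∀ {P} i k → k + i ≤ ℓ → Star (AdjIn P) (src (z i)) (src (z (k + i))) →
    ∃ λ (V : Dart → Bool) → (∀ d → V (φ d) ≡ V d) × (∀ d → ¬ P (src d) → V d xor V (rev d) ≡ Arc i k d)
  path-colouring i k k≤ w =
    let E , c , off = path-chain w
        S , flips = closed-chain-bounds c (arc-chain i k k≤) in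
    S ∘ face , (λ d → cong S (face-φ d)) , (λ d ¬p → trans (flips d) (cong (_xor Arc i k d) (off d ¬p)))

  -- At a vertex of the path `rot d` is `φ (rev d)`, and both steps preserve `T`; so `T` is constant
  -- around the vertex and across the edges of the path.
  constant-along-path : ∀ {P : Vertex → Set} (T : Dart → Bool) → (∀ d → P (src d) → T (rev d) ≡ T d) →
    (∀ d → P (src (φ d)) → T (φ d) ≡ T d) → ∀ {u v} → Star (AdjIn P) u v → P u → ∀ {a b} → src a ≡ u → src b ≡ v → T a ≡ T b
  constant-along-path {P} T T-rev T-φ w pu {a} {b} at-a at-b = go w pu at-a at-b
    where
    orbit : ∀ a k → P (src a) → T (fold a rot k) ≡ T a × P (src (fold a rot k))
    orbit a zero    p = refl , p
    orbit a (suc k) p = let eq , q = orbit a k p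
                            d = fold a rot k
                            q′ = subst P (sym (src-rot d)) q in
      trans (cong T (sym (φ-rev d))) (trans (T-φ (rev d) (subst (P ∘ src) (sym (φ-rev d)) q′)) (trans (T-rev d q) eq)) , q′
    at-vertex : ∀ a b → P (src a) → src a ≡ src b → T a ≡ T b
    at-vertex a b p eq = let k , eq′ = Equivalence.to (vertex-orbit a b) eq in trans (sym (proj₁ (orbit a k p))) (cong T eq′)
    go : ∀ {u v a b} → Star (AdjIn P) u v → P u → src a ≡ u → src b ≡ v → T a ≡ T b
    go {a = a} {b} ε pu refl eq = at-vertex a b pu (sym eq)
    go {a = a} ((e , se , te , pu , pv) ◅ w) _ refl eq =
      trans (at-vertex a e pu (sym se)) (trans (sym (T-rev e (subst P (sym se) pu))) (go w pv te eq))

  -- `V` does not change inside a face, and at each vertex passed the corners on side `β` agree by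
  -- `corners-constant`, because the vertex is off `P`.
  constant-along-curve : ∀ {ws β} (V : Dart → Bool) → (∀ d → V (φ d) ≡ V d) →
    (P : Vertex → Set) → (∀ d → ¬ P (src d) → ¬ OnZ d → V (rev d) ≡ V d) → (∀ {x} → x ∈ ws → ¬ P x) →
    ∀ {u v} → Star (ChordIn ws β) u v → ¬ P u → ∀ {a b} → src a ≡ u → src b ≡ v → inD a ≡ β → inD b ≡ β → V a ≡ V b
  constant-along-curve {ws} {β} V V-φ P V-rev avoid = go
    where
    at-corners : ∀ {v} → ¬ P v → ∀ {a b} → src a ≡ v → src b ≡ v → inD a ≡ β → inD b ≡ β → V a ≡ V b
    at-corners {v} ¬p = corners-constant β V v (λ d _ → V-φ d) (λ { d refl _ off → V-rev d ¬p off })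
    orbit : ∀ a k → V (fold a φ k) ≡ V a
    orbit a zero = refl
    orbit a (suc k) = trans (V-φ _) (orbit a k)
    go : ∀ {u v} → Star (ChordIn ws β) u v → ¬ P u → ∀ {a b} → src a ≡ u → src b ≡ v → inD a ≡ β → inD b ≡ β → V a ≡ V b
    go ε ¬p = at-corners ¬p
    go (c ◅ γ) ¬p at-a at-b in-a in-b =
      let k , eq = Equivalence.to (face-orbit out into) same-face in
      trans (at-corners ¬p at-a out-at in-a on) (trans (trans (sym (orbit out k)) (cong V eq))
        (go γ (avoid end) into-at at-b (trans (cong (Vec.lookup D) (sym same-face)) on) in-b))
      where
      open ChordIn c
      open Chord chord

  -- `rev (z i)` starts at the other end of the edge; the next dart of its face starts at
  -- `src (z i)` and takes its place.
  corner-at : ∀ β i → i ≤ ℓ → ∃ λ c → src c ≡ src (z i) × inD c ≡ β × (∀ (V : Dart → Bool) → (∀ d → V (φ d) ≡ V d) → V c ≡ V (side β i))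
  corner-at β i i≤ with β xor β₀ | inD-side β i≤
  ... | false | p = z i , refl , p , λ _ _ → refl
  ... | true  | p = φ (rev (z i)) , trans (src-φ _) (tgt-rev _) , trans (inD-φ _) p , λ V V-φ → V-φ _

  side-flip : ∀ (g : Dart → Bool) i → g (side true i) xor g (side false i) ≡ g (z i) xor g (rev (z i))
  side-flip g i with β₀
  ... | true  = refl
  ... | false = 𝔹.xor-comm (g (rev (z i))) (g (z i))

  side-both : ∀ (T : Dart → Bool) i → T (rev (z i)) ≡ T (z i) → ∀ β → T (side β i) ≡ T (z i)
  side-both T i eq β with β xor β₀
  ... | true  = eq
  ... | false = refl

  -- `V` colours the path in `P` closed by the arc, `U` the inner curve closed by the arc, so `T`
  -- colours path and inner curve together. The path in `Q` avoids both, hence `T` agrees at its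
  -- ends. On the outer side of `Z` `U` is constant, so `V` agrees there; on the inner side `V`
  -- agrees along the inner curve of `Q`. Yet `V` jumps across `z a`, which is on the arc, and not
  -- across `z b`.
  crossing-curves-meet : ∀ {P Q vs ws} i k {a b} → k + i ≤ ℓ → i ≤ a → a < k + i → b < ℓ → b < i ⊎ k + i ≤ b →
    Star (AdjIn P) (src (z i)) (src (z (k + i))) → Star (ChordIn vs true) (src (z i)) (src (z (k + i))) →
    Star (AdjIn Q) (src (z a)) (src (z b)) → Star (ChordIn ws true) (src (z a)) (src (z b)) →
    Q (src (z a)) → Q (src (z b)) →
    (∀ {x} → P x → ¬ Q x) → (∀ {x} → Q x → x ∉ vs) → (∀ {x} → x ∈ ws → ¬ P x) → ⊥
  crossing-curves-meet {P} {Q} i k {a} {b} k≤ i≤a a< b< b-out wP γP wQ γQ qa qb P∌Q Q∌vs ws∌P =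
    let U , U-rev , U-side , U-avoid = curve-colouring i k k≤ γP
        V , V-φ , V-rev = path-colouring i k k≤ wP
        arc-out = arc-off i k k≤
        T : Dart → Bool
        T d = U d xor V d
        T-rev : ∀ d → Q (src d) → T (rev d) ≡ T d
        T-rev d q = sym (xor-≡ (trans (xor-interchange (U d) _ _ _)
          (≡-xor (trans (U-rev d) (sym (V-rev d (λ p → P∌Q p q)))))))
        T-φ : ∀ d → Q (src (φ d)) → T (φ d) ≡ T d
        T-φ d q = cong₂ _xor_ (U-avoid d (Q∌vs q)) (V-φ d)
        T-ends : T (side false a) ≡ T (side false b)
        T-ends = trans (side-both T a (T-rev (z a) qa) false) (trans (constant-along-path T T-rev T-φ wQ qa refl refl)
          (sym (side-both T b (T-rev (z b) qb) false)))
        U-out : U (side false a) ≡ U (side false b)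
        U-out = side-constant false U (λ d out → U-side d (λ in-d → not-fixed in-d out))
          (λ d _ off → sym (xor-≡ (trans (U-rev d) (arc-out d off)))) (ℕₚ.<⇒≤ a<ℓ) (ℕₚ.<⇒≤ b<)
        V-out : V (side false a) ≡ V (side false b)
        V-out = xor-cancel-≡ T-ends U-out
        ca , ca-at , ca-in , ca-V = corner-at true a (ℕₚ.<⇒≤ a<ℓ)
        cb , cb-at , cb-in , cb-V = corner-at true b (ℕₚ.<⇒≤ b<)
        V-in : V (side true a) ≡ V (side true b)
        V-in = trans (sym (ca-V V V-φ)) (trans (constant-along-curve V V-φ P
          (λ d ¬p off → sym (xor-≡ (trans (V-rev d ¬p) (arc-out d off)))) ws∌P γQ (λ p → P∌Q p qa) ca-at cb-at ca-in cb-in) (cb-V V V-φ))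
        flip-a = trans (side-flip V a) (trans (V-rev (z a) (λ p → P∌Q p qa)) (arc-inside i k a k≤ i≤a a<))
        flip-b = trans (side-flip V b) (trans (V-rev (z b) (λ p → P∌Q p qb)) (arc-outside i k b k≤ b< b-out))
    in xor-true⇒≢ flip-a (trans V-in (trans (xor-≡ flip-b) (sym V-out)))
    where
    a<ℓ : a < ℓ
    a<ℓ = ℕₚ.<-≤-trans a< k≤

  -- `T` colours the closed curve made of the outer and the inner curve; the arc cancels. The path
  -- avoids both, so `T` agrees at its ends. `U` is constant on the inner side of `Z` and `W` on the
  -- outer side, so `W` agrees on both sides, although it jumps across `z a` only.
  separated-path-meets : ∀ {P qs rs} i k {a b} → k + i ≤ ℓ → i ≤ a → a < k + i → b < ℓ → b < i ⊎ k + i ≤ b →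
    Star (ChordIn qs false) (src (z i)) (src (z (k + i))) → Star (ChordIn rs true) (src (z i)) (src (z (k + i))) →
    Star (AdjIn P) (src (z a)) (src (z b)) → P (src (z a)) → P (src (z b)) →
    (∀ {x} → P x → x ∉ qs) → (∀ {x} → P x → x ∉ rs) → ⊥
  separated-path-meets {P} i k {a} {b} k≤ i≤a a< b< b-out γ δ w pa pb P∌qs P∌rs =
    let U , U-rev , U-side , U-avoid = curve-colouring i k k≤ γ
        W , W-rev , W-side , W-avoid = curve-colouring i k k≤ δ
        arc-out = arc-off i k k≤
        T : Dart → Bool
        T d = U d xor W d
        T-rev : ∀ d → T (rev d) ≡ T d
        T-rev d = sym (xor-≡ (trans (xor-interchange (U d) _ _ _) (≡-xor (trans (U-rev d) (sym (W-rev d))))))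
        T-φ : ∀ d → P (src (φ d)) → T (φ d) ≡ T d
        T-φ d p = cong₂ _xor_ (U-avoid d (P∌qs p)) (W-avoid d (P∌rs p))
        T-ends : T (side true a) ≡ T (side true b)
        T-ends = trans (side-both T a (T-rev (z a)) true) (trans (constant-along-path T (λ d _ → T-rev d) T-φ w pa refl refl)
          (sym (side-both T b (T-rev (z b)) true)))
        U-in : U (side true a) ≡ U (side true b)
        U-in = side-constant true U (λ d in-d → U-side d (λ out → not-fixed in-d out))
          (λ d _ off → sym (xor-≡ (trans (U-rev d) (arc-out d off)))) (ℕₚ.<⇒≤ a<ℓ) (ℕₚ.<⇒≤ b<)
        W-out : W (side false a) ≡ W (side false b)
        W-out = side-constant false W (λ d out → W-side d (λ in-d → not-fixed in-d out))
          (λ d _ off → sym (xor-≡ (trans (W-rev d) (arc-out d off)))) (ℕₚ.<⇒≤ a<ℓ) (ℕₚ.<⇒≤ b<)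
        flip-a = trans (side-flip W a) (trans (W-rev (z a)) (arc-inside i k a k≤ i≤a a<))
        flip-b = trans (side-flip W b) (trans (W-rev (z b)) (arc-outside i k b k≤ b< b-out))
    in xor-true⇒≢ flip-a (trans (xor-cancel-≡ T-ends U-in) (trans (xor-≡ flip-b) (sym W-out)))
    where
    a<ℓ : a < ℓ
    a<ℓ = ℕₚ.<-≤-trans a< k≤

-- Double counting over the outer faces

module Sweep {G : Graph} (connected : Graph.Connected G) (emb : SphereEmbedding G) (Z : Cycle G)
  (D : Subset (SphereEmbedding.f emb)) (disc : SphereEmbedding.IsDiscBoundedBy emb Z D) where
  open Graph G
  open SphereEmbedding emb
  open Colouring connected emb Z D disc public

  ∑-symmetric : ∀ g → (∀ d → g (rev d) ≡ g d) → ∑ g ≡ false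
  ∑-symmetric g g-rev = trans (∑-cong split) (trans (∑-xor h (h ∘ rev)) (≡-xor (∑-bij rev↔ h)))
    where
    h : Dart → Bool
    h d = proj₂ d ∧ g d
    split : ∀ d → g d ≡ h d xor h (rev d)
    split (e , true)  = sym (𝔹.xor-identityʳ _)
    split (e , false) = sym (g-rev (e , false))

  z-inD : ∀ {i} → i ≤ ℓ → inD (z i) ≡ false ⊎ inD (rev (z i)) ≡ false
  z-inD {i} i≤ with inD (z i) in eq
  ... | false = inj₁ refl
  ... | true  = inj₂ (trans (inD-on (z i) (z-on i≤)) (cong not eq))

  side-edge : ∀ β i → edge (side β i) ≡ edge (z i)
  side-edge β i with β xor β₀
  ... | true  = refl
  ... | false = refl

  sideSpots : ℕ → Dart → Bool
  sideSpots zero    d = false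
  sideSpots (suc k) d = sideSpots k d xor spot (side false k) d

  sideSpots-absent : ∀ k d → (∀ i → i < k → d ≢ side false i) → sideSpots k d ≡ false
  sideSpots-absent zero    d absent = refl
  sideSpots-absent (suc k) d absent = cong₂ _xor_ (sideSpots-absent k d (λ i i< → absent i (ℕₚ.m≤n⇒m≤1+n i<)))
    (spot-false (absent k ℕₚ.≤-refl))

  sideSpots-present : ∀ k i → i < k → k ≤ ℓ → sideSpots k (side false i) ≡ true
  sideSpots-present (suc k) i i< k< with i ℕₚ.≟ k
  ... | yes refl = cong₂ _xor_ (sideSpots-absent k _ (λ j j< eq → ℕₚ.<-irrefl (sym (same eq (ℕₚ.<-trans j< k<) k<)) j<)) (spot-true (side false k))
    where
    same : ∀ {i j} → side false i ≡ side false j → j < ℓ → i < ℓ → i ≡ j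
    same {i} {j} eq j< i< = z-edge-injective i< j< (trans (sym (side-edge false i)) (trans (cong edge eq) (side-edge false j)))
  ... | no ≢ = cong₂ _xor_ (sideSpots-present k i (ℕₚ.≤∧≢⇒< (s≤s⁻¹ i<) ≢) (ℕₚ.<⇒≤ k<))
    (spot-false (λ eq → ≢ (z-edge-injective (ℕₚ.<-≤-trans i< k<) k< (trans (sym (side-edge false i)) (trans (cong edge eq) (side-edge false k))))))

  on⇒side : ∀ d → OnZ d → inD d ≡ false → ∃ λ i → i < ℓ × d ≡ side false i
  on⇒side d on out with on⇒z d on
  ... | i , i< , same = i , i< , choose (same-edge {d = d} {side false i} (trans (edge-of same) (sym (side-edge false i))))
    where
    edge-of : d ≡ z i ⊎ d ≡ rev (z i) → edge d ≡ edge (z i)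
    edge-of (inj₁ refl) = refl
    edge-of (inj₂ refl) = refl
    choose : d ≡ side false i ⊎ d ≡ rev (side false i) → d ≡ side false i
    choose (inj₁ eq) = eq
    choose (inj₂ eq) = ⊥-elim (not-fixed (trans (inD-side false (ℕₚ.<⇒≤ i<)) (sym out))
      (trans (cong inD (trans (sym (rev′-involutive (side false i))) (cong rev (sym eq)))) (inD-on d on)))

  sideSpots-frontier : ∀ d → sideSpots ℓ d ≡ not (inD d) ∧ inD (rev d)
  sideSpots-frontier d with onZ? d
  ... | no off = trans (sideSpots-absent ℓ d (λ i i< eq → off (subst (_∈ Cycle.edges Z)
                   (trans (sym (side-edge false i)) (cong edge (sym eq))) (z-on (ℕₚ.<⇒≤ i<)))))
                   (trans (sym (𝔹.∧-inverseˡ (inD d))) (cong (not (inD d) ∧_) (sym (inD-off d off))))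
  ... | yes on with inD d in eq
  ...   | true  = sideSpots-absent ℓ d (λ i i< same → not-fixed eq (trans (cong inD same) (inD-side false (ℕₚ.<⇒≤ i<))))
  ...   | false with on⇒side d on eq
  ...     | i , i< , refl = trans (sideSpots-present ℓ i i< ℕₚ.≤-refl) (sym (trans (inD-on (side false i) on) (cong not eq)))

  along : (Dart → Bool) → ℕ → Bool
  along g zero    = false
  along g (suc k) = along g k xor g (side false k)

  ∑-sideSpots : ∀ g k → ∑ (λ d → sideSpots k d ∧ g d) ≡ along g k
  ∑-sideSpots g zero    = ∑-false (λ _ → refl)
  ∑-sideSpots g (suc k) = trans (∑-cong (λ d → 𝔹.∧-distribʳ-xor (g d) (sideSpots k d) _)) (trans (∑-xor _ _)
    (cong₂ _xor_ (∑-sideSpots g k) (trans (∑-single (side false k) _ (λ x ≢ → cong (_∧ g x) (spot-false ≢)))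
      (cong (_∧ g (side false k)) (spot-true (side false k))))))

  -- Edges off Z are counted once from each side, so only the frontier survives mod 2.
  ∑-outside : ∀ g → (∀ d → g (rev d) ≡ g d) → ∑ (λ d → not (inD d) ∧ g d) ≡ along g ℓ
  ∑-outside g g-rev = trans (∑-cong (λ d → split (inD d) (inD (rev d)) (g d))) (trans (∑-xor _ _)
    (cong₂ _xor_ (∑-symmetric _ both-rev) (trans (∑-cong (λ d → cong (_∧ g d) (sym (sideSpots-frontier d)))) (∑-sideSpots g ℓ))))
    where
    split : ∀ x y w → not x ∧ w ≡ ((not x ∧ not y) ∧ w) xor ((not x ∧ y) ∧ w)
    split true  _     _ = refl
    split false true  _ = refl
    split false false w = sym (𝔹.xor-identityʳ w)
    both-rev : ∀ d → (not (inD (rev d)) ∧ not (inD (rev (rev d)))) ∧ g (rev d) ≡ (not (inD d) ∧ not (inD (rev d))) ∧ g d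
    both-rev d = cong₂ _∧_ (trans (cong (λ x → not (inD (rev d)) ∧ not (inD x)) (rev′-involutive d)) (𝔹.∧-comm (not (inD (rev d))) _)) (g-rev d)

  -- `X` is a region, `Y` the union of the regions inside it, and `S` is closed under outer edges
  -- within `X` minus `Y`, like a component. `nbr` puts every vertex of an outer face that meets `Y`
  -- into `X`.
  module _ (X Y S : Vertex → Bool) (a b : ℕ) (a≤b : a ≤ b) (b<ℓ : b < ℓ)
    (S∌Y : ∀ v → S v ≡ true → Y v ≡ false)
    (nbr : ∀ d e → face d ≡ face e → inD d ≡ false → Y (src d) ≡ true → X (src e) ≡ true)
    (S-closed : ∀ d → inD d ≡ false ⊎ inD (rev d) ≡ false → S (src d) ≡ true → X (tgt d) ≡ true → Y (tgt d) ≡ false → S (tgt d) ≡ true)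
    (X-arc : ∀ i → a ≤ i → i ≤ b → X (src (z i)) ≡ true)
    (Y-arc : ∀ i → i < ℓ → Y (src (z i)) ≡ true → a < i × i < b) where

    private
      SY : Dart → Bool
      SY d = (S (src d) ∧ Y (tgt d)) xor (Y (src d) ∧ S (tgt d))

      SY-rev : ∀ d → SY (rev d) ≡ SY d
      SY-rev d rewrite rev′-involutive d = trans (𝔹.xor-comm (S (tgt d) ∧ Y (src d)) _)
        (cong₂ _xor_ (𝔹.∧-comm (Y (tgt d)) _) (𝔹.∧-comm (S (tgt d)) _))

      SY-empty : ∀ d → Y (src d) ≡ false → Y (tgt d) ≡ false → SY d ≡ false
      SY-empty d p q rewrite p | q = trans (𝔹.xor-identityʳ _) (𝔹.∧-zeroʳ (S (src d)))

      -- Within `X` an outer edge can leave `S` only into `Y`, by `S-closed`.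
      SY-change : ∀ d → inD d ≡ false ⊎ inD (rev d) ≡ false → X (src d) ≡ true → X (tgt d) ≡ true → SY d ≡ S (src d) xor S (tgt d)
      SY-change d out xs xt = cases (S∌Y (src d)) (S∌Y (tgt d)) (S-closed d out)
        (λ st ys → trans (cong S (sym (tgt-rev d))) (S-closed (rev d) (Sum.swap (Sum.map₁ (trans (cong inD (rev′-involutive d))) out)) st (trans (cong X (tgt-rev d)) xs) (trans (cong Y (tgt-rev d)) ys)))
        where
        cases : ∀ {s t y y′} → (s ≡ true → y ≡ false) → (t ≡ true → y′ ≡ false) →
          (s ≡ true → X (tgt d) ≡ true → y′ ≡ false → t ≡ true) → (t ≡ true → y ≡ false → s ≡ true) →
          (s ∧ y′) xor (y ∧ t) ≡ s xor t
        cases {true}  {true}  p q _ _ rewrite p refl | q refl = refl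
        cases {true}  {false} {y} {true}  p _ _ _ rewrite p refl = refl
        cases {true}  {false} {y} {false} p _ r _ = ⊥-elim (not-fixed (r refl xt refl) refl)
        cases {false} {true}  {true} _ _ _ _ = refl
        cases {false} {true}  {false} _ _ _ r = ⊥-elim (not-fixed (r refl refl) refl)
        cases {false} {false} {y} _ _ _ _ = 𝔹.∧-zeroʳ y

      touches? : ∀ F → Dec (∃ λ d → face d ≡ F × Y (src d) ≡ true)
      touches? F = anyDart? (λ d → (face d Finₚ.≟ F) ×-dec (Y (src d) 𝔹.≟ true))

      touched : Face → Bool
      touched F = does (touches? F)

      -- An outer face that meets `Y` lies in `X` by `nbr`, so `SY-change` applies all along it; any
      -- other outer face carries no `S`-`Y` edge.
      SY-face : ∀ d → not (inD d) ∧ SY d ≡ (not (inD d) ∧ touched (face d)) ∧ (S (src d) xor S (src (φ d)))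
      SY-face d with inD d in out
      ... | true = refl
      ... | false with touches? (face d)
      ...   | yes (e , same , y) = trans
                (SY-change d (inj₁ out) (nbr e d same out-e y)
                  (trans (cong X (sym (src-φ d))) (nbr e (φ d) (trans same (sym (face-φ d))) out-e y)))
                (cong (λ v → S (src d) xor S v) (sym (src-φ d)))
        where
        out-e : inD e ≡ false
        out-e = trans (cong (Vec.lookup D) same) out
      ...   | no none = SY-empty d (𝔹.¬-not (λ y → none (d , refl , y)))
                (𝔹.¬-not (λ y → none (φ d , face-φ d , trans (cong Y (src-φ d)) y)))

      -- The changes of `S` cancel around each face, as `φ` permutes its darts. `∑-outside` turns
      -- the sum over outer darts into one along `Z`.
      SY-sum : along SY ℓ ≡ false
      SY-sum = trans (sym (∑-outside SY SY-rev)) (trans (∑-cong SY-face)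
        (trans (∑-cong (λ d → trans (𝔹.∧-distribˡ-xor (c d) _ _) (cong (λ x → g d xor (x ∧ S (src (φ d)))) (sym (c-φ d)))))
          (trans (∑-xor g (g ∘ φ)) (≡-xor (∑-bij φ↔ g)))))
        where
        c g : Dart → Bool
        c d = not (inD d) ∧ touched (face d)
        g d = c d ∧ S (src d)
        c-φ : ∀ d → c (φ d) ≡ c d
        c-φ d = cong₂ _∧_ (cong not (inD-φ d)) (cong touched (face-φ d))

      SY-side : ∀ i → SY (side false i) ≡ SY (z i)
      SY-side i with false xor β₀
      ... | true  = SY-rev (z i)
      ... | false = refl

      no-Y : ∀ i → i ≤ ℓ → i ≤ a ⊎ b ≤ i → Y (src (z i)) ≡ false
      no-Y i i≤ out with ℕₚ.m≤n⇒m<n∨m≡n i≤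
      ... | inj₂ refl = 𝔹.¬-not (λ y → ℕₚ.n≮0 (proj₁ (Y-arc 0 (s≤s z≤n) (trans (cong (Y ∘ src) (sym z-wrap)) y))))
      ... | inj₁ i< = 𝔹.¬-not (λ y → contra out (Y-arc i i< y))
        where
        contra : i ≤ a ⊎ b ≤ i → ¬ (a < i × i < b)
        contra (inj₁ p) (q , _) = ℕₚ.<⇒≱ q p
        contra (inj₂ p) (_ , q) = ℕₚ.<⇒≱ q p

      before : ∀ k → k ≤ a → along SY k ≡ false
      before zero    _  = refl
      before (suc k) k< = cong₂ _xor_ (before k (ℕₚ.<⇒≤ k<)) (trans (SY-side k)
        (SY-empty (z k) (no-Y k (ℕₚ.<⇒≤ k<ℓ) (inj₁ (ℕₚ.<⇒≤ k<))) (trans (cong Y (z-link k<ℓ)) (no-Y (suc k) k<ℓ (inj₁ k<)))))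
        where
        k<ℓ : k < ℓ
        k<ℓ = ℕₚ.<-trans (ℕₚ.<-≤-trans k< a≤b) b<ℓ

      within : ∀ k → k + a ≤ b → along SY (k + a) ≡ S (src (z a)) xor S (src (z (k + a)))
      within zero    _  = trans (before a ℕₚ.≤-refl) (sym (𝔹.xor-same (S (src (z a)))))
      within (suc k) k< = trans (cong₂ _xor_ (within k (ℕₚ.<⇒≤ k<)) (trans (SY-side i)
          (trans (SY-change (z i) (z-inD (ℕₚ.<⇒≤ i<ℓ)) (X-arc i (ℕₚ.m≤n+m a k) (ℕₚ.<⇒≤ k<))
              (trans (cong X (z-link i<ℓ)) (X-arc (suc i) (ℕₚ.m≤n+m a (suc k)) k<)))
            (cong (λ v → S (src (z i)) xor S v) (z-link i<ℓ)))))
        (trans (𝔹.xor-assoc (S (src (z a))) _ _) (cong (S (src (z a)) xor_) (xor-cancelˡ (S (src (z i))) _)))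
        where
        i : ℕ
        i = k + a
        i<ℓ : i < ℓ
        i<ℓ = ℕₚ.<-trans k< b<ℓ

      after : ∀ k → k + b ≤ ℓ → along SY (k + b) ≡ S (src (z a)) xor S (src (z b))
      after zero    _  = subst (λ k → along SY k ≡ S (src (z a)) xor S (src (z k))) (ℕₚ.m∸n+n≡m a≤b)
        (within (b ∸ a) (ℕₚ.≤-reflexive (ℕₚ.m∸n+n≡m a≤b)))
      after (suc k) k< = trans (cong₂ _xor_ (after k (ℕₚ.<⇒≤ k<)) (trans (SY-side (k + b))
        (SY-empty (z (k + b)) (no-Y (k + b) (ℕₚ.<⇒≤ k<) (inj₂ (ℕₚ.m≤n+m b k)))
          (trans (cong Y (z-link k<)) (no-Y (suc (k + b)) k< (inj₂ (ℕₚ.m≤n+m b (suc k))))))))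
        (𝔹.xor-identityʳ _)

    -- Around every outer face that meets Y all changes of S are S–Y edges, so their number is even;
    -- hence it is even along Z too, where the changes of S occur between a and b only.
    arc-ends-agree : S (src (z a)) ≡ S (src (z b))
    arc-ends-agree = xor-≡ (trans (sym (after (ℓ ∸ b) (ℕₚ.≤-reflexive (ℕₚ.m∸n+n≡m (ℕₚ.<⇒≤ b<ℓ)))))
      (trans (cong (along SY) (ℕₚ.m∸n+n≡m (ℕₚ.<⇒≤ b<ℓ))) SY-sum))

-- Counting in lists

module _ {A : Set} where
  count : {P : A → Set} → Decidable P → List A → ℕ
  count P? xs = length (filter P? xs)

  count-≤ : ∀ {P Q : A → Set} (P? : Decidable P) (Q? : Decidable Q) xs → (∀ {x} → x ∈ xs → P x → Q x) → count P? xs ≤ count Q? xs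
  count-≤ P? Q? [] _ = z≤n
  count-≤ P? Q? (x ∷ xs) imp with P? x | Q? x
  ... | yes p | no ¬q = ⊥-elim (¬q (imp (here refl) p))
  ... | yes _ | yes _ = s≤s (count-≤ P? Q? xs (imp ∘ there))
  ... | no _  | yes _ = ℕₚ.m≤n⇒m≤1+n (count-≤ P? Q? xs (imp ∘ there))
  ... | no _  | no _  = count-≤ P? Q? xs (imp ∘ there)

  count-< : ∀ {P Q : A → Set} (P? : Decidable P) (Q? : Decidable Q) {xs a} → (∀ {x} → x ∈ xs → P x → Q x) →
    a ∈ xs → Q a → ¬ P a → count P? xs < count Q? xs
  count-< P? Q? {x ∷ xs} imp (here refl) q ¬p with P? x | Q? x
  ... | yes p | _     = ⊥-elim (¬p p)
  ... | _     | no ¬q = ⊥-elim (¬q q)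
  ... | no _  | yes _ = s≤s (count-≤ P? Q? xs (imp ∘ there))
  count-< P? Q? {x ∷ xs} imp (there a∈) q ¬p with P? x | Q? x
  ... | yes p | no ¬q = ⊥-elim (¬q (imp (here refl) p))
  ... | yes _ | yes _ = s≤s (count-< P? Q? (imp ∘ there) a∈ q ¬p)
  ... | no _  | yes _ = ℕₚ.m≤n⇒m≤1+n (count-< P? Q? (imp ∘ there) a∈ q ¬p)
  ... | no _  | no _  = count-< P? Q? (imp ∘ there) a∈ q ¬p

  count-⊎ : ∀ {P Q R : A → Set} (P? : Decidable P) (Q? : Decidable Q) (R? : Decidable R) xs →
    (∀ {x} → x ∈ xs → P x → Q x ⊎ R x) → count P? xs ≤ count Q? xs + count R? xs
  count-⊎ P? Q? R? [] _ = z≤n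
  count-⊎ P? Q? R? (x ∷ xs) imp with P? x | Q? x | R? x | count-⊎ P? Q? R? xs (imp ∘ there)
  ... | no _  | no _  | no _  | ih = ih
  ... | no _  | no _  | yes _ | ih = ℕₚ.≤-trans ih (ℕₚ.+-monoʳ-≤ _ (ℕₚ.n≤1+n _))
  ... | no _  | yes _ | no _  | ih = ℕₚ.m≤n⇒m≤1+n ih
  ... | no _  | yes _ | yes _ | ih = ℕₚ.m≤n⇒m≤1+n (ℕₚ.≤-trans ih (ℕₚ.+-monoʳ-≤ _ (ℕₚ.n≤1+n _)))
  ... | yes _ | yes _ | no _  | ih = s≤s ih
  ... | yes _ | yes _ | yes _ | ih = s≤s (ℕₚ.≤-trans ih (ℕₚ.+-monoʳ-≤ _ (ℕₚ.n≤1+n _)))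
  ... | yes _ | no _  | yes _ | ih = ℕₚ.≤-trans (s≤s ih) (ℕₚ.≤-reflexive (sym (ℕₚ.+-suc _ _)))
  ... | yes p | no ¬q | no ¬r | _ with imp (here refl) p
  ...   | inj₁ q = ⊥-elim (¬q q)
  ...   | inj₂ r = ⊥-elim (¬r r)

  count-all : ∀ {P : A → Set} (P? : Decidable P) {xs} → (∀ {x} → x ∈ xs → P x) → count P? xs ≡ length xs
  count-all P? p = cong length (Listₚ.filter-all P? (All.tabulate p))

  count-filter : ∀ {P Q : A → Set} (P? : Decidable P) (Q? : Decidable Q) xs → count P? (filter Q? xs) ≤ count P? xs
  count-filter P? Q? [] = z≤n
  count-filter P? Q? (x ∷ xs) with Q? x
  ... | no _ with P? x
  ...   | yes _ = ℕₚ.m≤n⇒m≤1+n (count-filter P? Q? xs)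
  ...   | no _  = count-filter P? Q? xs
  count-filter P? Q? (x ∷ xs) | yes _ with P? x
  ...   | yes _ = s≤s (count-filter P? Q? xs)
  ...   | no _  = count-filter P? Q? xs

  count-unique : ∀ {a : A} (≟a : Decidable (_≡ a)) {xs} → Unique xs → count ≟a xs ≤ 1
  count-unique {a} ≟a {xs} u = unique-⊆⇒length-≤ {ys = a ∷ []} (Uniqueₚ.filter⁺ ≟a u) (λ x∈ → here (proj₂ (∈-filter⁻ ≟a {xs = xs} x∈)))

  sum-≤ : ∀ (f g : A → ℕ) xs → (∀ {x} → x ∈ xs → f x ≤ g x) → sum (map f xs) ≤ sum (map g xs)
  sum-≤ f g [] _ = z≤n
  sum-≤ f g (x ∷ xs) le = ℕₚ.+-mono-≤ (le (here refl)) (sum-≤ f g xs (le ∘ there))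

  sum-const : ∀ c (xs : List A) → sum (map (λ _ → c) xs) ≡ length xs * c
  sum-const c [] = refl
  sum-const c (x ∷ xs) = cong (c +_) (sum-const c xs)

  module _ {R : A → A → Set} (R? : ∀ x y → Dec (R x y)) where
    private
      out in′ : List A → A → ℕ
      out ys x = count (R? x) ys
      in′ xs y = count (λ x → R? x y) xs

      in-cons : ∀ x xs ys → sum (map (in′ (x ∷ xs)) ys) ≡ out ys x + sum (map (in′ xs) ys)
      in-cons x xs [] = refl
      in-cons x xs (y ∷ ys) with R? x y
      ... | no _  = trans (cong (in′ xs y +_) (in-cons x xs ys)) (+-exchange (in′ xs y) (out ys x) _)
      ... | yes _ = cong suc (trans (cong (in′ xs y +_) (in-cons x xs ys)) (+-exchange (in′ xs y) (out ys x) _))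

    double-count : ∀ xs ys → sum (map (λ x → count (R? x) ys) xs) ≡ sum (map (λ y → count (λ x → R? x y) xs) ys)
    double-count [] ys = sym (trans (sum-const 0 ys) (ℕₚ.*-zeroʳ (length ys)))
    double-count (x ∷ xs) ys = trans (cong (out ys x +_) (double-count xs ys)) (sym (in-cons x xs ys))

    -- Out-degrees and in-degrees have the same sum, so the average out-degree is at most `ρ` as
    -- well.
    low-degree : ∀ {ρ x xs} → x ∈ xs → (∀ y → count (λ x → R? x y) xs ≤ ρ) → ∃ λ x → x ∈ xs × count (R? x) xs ≤ ρ
    low-degree {ρ} {x} {xs} x∈ bound with Any.any? (λ x → count (R? x) xs ℕₚ.≤? ρ) xs
    ... | yes found = let y , y∈ , p = find found in y , y∈ , p
    ... | no none = ⊥-elim (ℕₚ.<⇒≱ fewer (begin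
        length xs * suc ρ                                ≡⟨ sum-const (suc ρ) xs ⟨
        sum (map (λ _ → suc ρ) xs)                       ≤⟨ sum-≤ _ _ xs (λ y∈ → ℕₚ.≰⇒> (λ le → none (lose y∈ le))) ⟩
        sum (map (λ x → count (R? x) xs) xs)             ≡⟨ double-count xs xs ⟩
        sum (map (λ y → count (λ x → R? x y) xs) xs)     ≤⟨ sum-≤ _ (λ _ → ρ) xs (λ _ → bound _) ⟩
        sum (map (λ _ → ρ) xs)                           ≡⟨ sum-const ρ xs ⟩
        length xs * ρ                                    ∎))
      where
      open ℕₚ.≤-Reasoning
      nonempty : ∀ {xs : List A} → x ∈ xs → 0 < length xs
      nonempty {_ ∷ _} _ = s≤s z≤n
      fewer : length xs * ρ < length xs * suc ρ
      fewer = subst (length xs * ρ <_) (sym (ℕₚ.*-suc (length xs) ρ)) (ℕₚ.m<n+m (length xs * ρ) (nonempty x∈))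

    -- A digraph with in-degrees at most ρ has a vertex of total degree at most 2ρ in every induced subgraph.
    independent : ∀ {ρ} xs → (∀ x → R x x) → (∀ y → count (λ x → R? x y) xs ≤ ρ) →
      ∃ λ ys → (∀ {y} → y ∈ ys → y ∈ xs) × AllPairs (λ x y → ¬ R x y × ¬ R y x) ys × length xs ≤ length ys * (ρ + ρ)
    independent {ρ} xs R-refl bound = go (length xs) xs ℕₚ.≤-refl bound
      where
      Free : A → A → Set
      Free x y = ¬ R x y × ¬ R y x
      free? : ∀ x → Decidable (Free x)
      free? x y = ¬? (R? x y) ×-dec ¬? (R? y x)
      go : ∀ fuel xs → length xs ≤ fuel → (∀ y → count (λ x → R? x y) xs ≤ ρ) →
        ∃ λ ys → (∀ {y} → y ∈ ys → y ∈ xs) × AllPairs Free ys × length xs ≤ length ys * (ρ + ρ)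
      go _ [] _ _ = [] , (λ ()) , [] , z≤n
      go (suc fuel) xs@(_ ∷ _) len bound with low-degree {ρ} (here refl) bound
      ... | x , x∈ , low =
        -- The elements dropped with `x` are its in- and out-neighbours, at most `ρ + ρ`. By
        -- reflexivity `x` is among them, so the list gets shorter.
        let xs′ = filter (free? x) xs
            shorter = Listₚ.filter-notAll (free? x) xs (Any.map (λ { refl (¬r , _) → ¬r (R-refl x) }) x∈)
            ys , sub , indep , size = go fuel xs′ (s≤s⁻¹ (ℕₚ.≤-trans shorter len))
              (λ y → ℕₚ.≤-trans (count-filter (λ x → R? x y) (free? x) xs) (bound y))
        in x ∷ ys
         , (λ { (here refl) → x∈ ; (there y∈) → proj₁ (∈-filter⁻ (free? x) {xs = xs} (sub y∈)) })
         , All.tabulate (λ y∈ → proj₂ (∈-filter⁻ (free? x) {xs = xs} (sub y∈))) ∷ indep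
         , ℕₚ.≤-trans (split x xs) (ℕₚ.+-mono-≤ (ℕₚ.+-mono-≤ low (bound x)) size)
        where
        split : ∀ x xs → length xs ≤ (count (R? x) xs + count (λ y → R? y x) xs) + count (free? x) xs
        split x xs = ℕₚ.≤-trans (ℕₚ.≤-reflexive (sym (count-all (λ _ → yes refl) {xs} (λ {y} _ → refl {x = y}))))
          (ℕₚ.≤-trans (count-⊎ (λ _ → yes refl) either? (free? x) xs (λ {y} _ _ → decide y))
            (ℕₚ.+-monoˡ-≤ _ (count-⊎ either? (R? x) (λ y → R? y x) xs (λ _ p → p))))
          where
          either? : Decidable (λ y → R x y ⊎ R y x)
          either? y = R? x y ⊎-dec R? y x
          decide : ∀ y → (R x y ⊎ R y x) ⊎ Free x y
          decide y with R? x y | R? y x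
          ... | yes p | _     = inj₁ (inj₁ p)
          ... | no _  | yes q = inj₁ (inj₂ q)
          ... | no ¬p | no ¬q = inj₂ (¬p , ¬q)

  -- Pigeonhole by induction on the number of values: the larger of the class of `K` and the best
  -- class among the smaller values.
  popular-value : ∀ K (g : A → ℕ) xs → (∀ {x} → x ∈ xs → g x < K) → ∃ λ r → length xs ≤ K * count (λ x → g x ℕₚ.≟ r) xs
  popular-value zero g [] _ = 0 , z≤n
  popular-value zero g (x ∷ xs) small with small (here refl)
  ... | ()
  popular-value (suc K) g xs small =
    let rest = filter (λ x → ¬? (g x ℕₚ.≟ K)) xs
        r , p = popular-value K g rest (λ x∈ → let x∈′ , ≢ = ∈-filter⁻ (λ x → ¬? (g x ℕₚ.≟ K)) {xs = xs} x∈ in ℕₚ.≤∧≢⇒< (s≤s⁻¹ (small x∈′)) ≢)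
        c = count (λ x → g x ℕₚ.≟ K) xs
        e = count (λ x → g x ℕₚ.≟ r) xs
        total : length xs ≤ c + K * e
        total = ℕₚ.≤-trans (ℕₚ.≤-reflexive (sym (count-all (λ _ → yes refl) {xs} (λ {y} _ → refl {x = y}))))
          (ℕₚ.≤-trans (count-⊎ (λ _ → yes refl) (λ x → g x ℕₚ.≟ K) (λ x → ¬? (g x ℕₚ.≟ K)) xs (λ {x} _ _ → either (g x ℕₚ.≟ K)))
            (ℕₚ.+-monoʳ-≤ c (ℕₚ.≤-trans p (ℕₚ.*-monoʳ-≤ K (count-filter (λ x → g x ℕₚ.≟ r) _ xs)))))
    in choose total (ℕₚ.≤-total c e)
    where
    either : ∀ {P : Set} → Dec P → P ⊎ ¬ P
    either (yes p) = inj₁ p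
    either (no ¬p) = inj₂ ¬p
    choose : ∀ {r} → let c = count (λ x → g x ℕₚ.≟ K) xs
                         e = count (λ x → g x ℕₚ.≟ r) xs in
      length xs ≤ c + K * e → c ≤ e ⊎ e ≤ c → ∃ λ r → length xs ≤ suc K * count (λ x → g x ℕₚ.≟ r) xs
    choose {r} total (inj₁ le) = r , ℕₚ.≤-trans total (ℕₚ.+-monoˡ-≤ _ le)
    choose     total (inj₂ le) = K , ℕₚ.≤-trans total (ℕₚ.+-monoʳ-≤ _ (ℕₚ.*-monoʳ-≤ K le))

  -- One common vertex is chosen for each path; disjointness makes the choices distinct elements of
  -- `vs`.
  hitting-bound : ∀ {V : Set} (path : A → List V) → (∀ {i j} → i ≢ j → Disjoint (path i) (path j)) →
    ∀ {is} vs → Unique is → (∀ {i} → i ∈ is → ∃ λ v → v ∈ path i × v ∈ vs) → length is ≤ length vs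
  hitting-bound {V} path disj {is} vs u hit =
    let ws , uw , sub , _ , len = choose is u hit in subst (_≤ length vs) len (unique-⊆⇒length-≤ uw sub)
    where
    choose : ∀ is → Unique is → (∀ {i} → i ∈ is → ∃ λ v → v ∈ path i × v ∈ vs) →
      ∃ λ ws → Unique ws × (∀ {w} → w ∈ ws → w ∈ vs) × (∀ {w} → w ∈ ws → ∃ λ i → i ∈ is × w ∈ path i) × length ws ≡ length is
    choose [] _ _ = [] , [] , (λ ()) , (λ ()) , refl
    choose (i ∷ is) (new ∷ u) hit =
      let v , v∈ , v∈vs = hit (here refl)
          ws , uw , sub , owner , len = choose is u (hit ∘ there)
      in v ∷ ws
       , ∉⇒All≢ (λ v∈ws → let j , j∈ , v∈j = owner v∈ws in disj (All.lookup new j∈) (v∈ , v∈j)) ∷ uw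
       , (λ { (here refl) → v∈vs ; (there w∈) → sub w∈ })
       , (λ { (here refl) → i , here refl , v∈ ; (there w∈) → let j , j∈ , p = owner w∈ in j , there j∈ , p })
       , cong suc len

-- Rerouting along the frontiers of nested regions

AllPairs-lookup : ∀ {A : Set} {R : A → A → Set} {xs x y} → AllPairs R xs → x ∈ xs → y ∈ xs → x ≢ y → R x y ⊎ R y x
AllPairs-lookup (_ ∷ _)  (here refl) (here refl) ≢ = ⊥-elim (≢ refl)
AllPairs-lookup (r ∷ _)  (here refl) (there y∈)  _ = inj₁ (All.lookup r y∈)
AllPairs-lookup (r ∷ _)  (there x∈)  (here refl) _ = inj₂ (All.lookup r x∈)
AllPairs-lookup (_ ∷ rs) (there x∈)  (there y∈)  ≢ = AllPairs-lookup rs x∈ y∈ ≢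

-- Nesting depth in a laminar family of arcs

module Nesting {k : ℕ} (lo hi : Fin k → ℕ) (lo≤hi : ∀ i → lo i ≤ hi i) (js : List (Fin k)) (js-unique : Unique js)
  (laminar : ∀ {i j} → i ∈ js → j ∈ js → i ≢ j → (lo j < lo i × hi i < hi j) ⊎ (lo i < lo j × hi j < hi i) ⊎ hi i < lo j ⊎ hi j < lo i)
  (K : ℕ) ⦃ _ : NonZero K ⦄ (r : ℕ) where

  infix 4 _⊏_ _⊏?_

  _⊏_ : Fin k → Fin k → Set
  i ⊏ j = lo j < lo i × hi i < hi j

  _⊏?_ : ∀ i j → Dec (i ⊏ j)
  i ⊏? j = (lo j ℕₚ.<? lo i) ×-dec (hi i ℕₚ.<? hi j)

  ⊏-trans : ∀ {i j l} → i ⊏ j → j ⊏ l → i ⊏ l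
  ⊏-trans (a , b) (c , d) = ℕₚ.<-trans c a , ℕₚ.<-trans b d

  depth level : Fin k → ℕ
  depth i = count (i ⊏?_) js
  level i = depth i / K

  Between : Fin k → Fin k → Fin k → Set
  Between j i c = j ⊏ c × c ⊏ i

  between? : ∀ j i → Decidable (Between j i)
  between? j i c = (j ⊏? c) ×-dec (c ⊏? i)

  -- An arc around `j` meets `i`, since it also contains `j`; by laminarity it lies inside `i`,
  -- equals `i` or contains `i`.
  depth-between : ∀ {i j} → i ∈ js → j ⊏ i → depth j ≤ count (between? j i) js + suc (depth i)
  depth-between {i} {j} i∈ (lt , gt) = ℕₚ.≤-trans
    (count-⊎ (j ⊏?_) (between? j i) ⊒? js (λ {c} c∈ j⊏c → split c c∈ j⊏c (c Finₚ.≟ i)))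
    (ℕₚ.+-monoʳ-≤ (count (between? j i) js)
      (ℕₚ.≤-trans (count-⊎ ⊒? (Finₚ._≟ i) (i ⊏?_) js (λ _ p → p)) (ℕₚ.+-monoˡ-≤ (depth i) (count-unique (Finₚ._≟ i) js-unique))))
    where
    ⊒? : Decidable (λ c → c ≡ i ⊎ i ⊏ c)
    ⊒? c = (c Finₚ.≟ i) ⊎-dec (i ⊏? c)
    split : ∀ c → c ∈ js → j ⊏ c → Dec (c ≡ i) → Between j i c ⊎ (c ≡ i ⊎ i ⊏ c)
    split c c∈ j⊏c (yes eq) = inj₂ (inj₁ eq)
    split c c∈ j⊏c@(lt′ , gt′) (no ≢) with laminar c∈ i∈ ≢
    ... | inj₁ c⊏i = inj₁ (j⊏c , c⊏i)
    ... | inj₂ (inj₁ i⊏c) = inj₂ (inj₂ i⊏c)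
    ... | inj₂ (inj₂ (inj₁ apart)) = ⊥-elim (ℕₚ.<-asym (ℕₚ.<-≤-trans lt (lo≤hi j)) (ℕₚ.<-trans gt′ apart))
    ... | inj₂ (inj₂ (inj₂ apart)) = ⊥-elim (ℕₚ.<-asym (ℕₚ.<-≤-trans lt′ (lo≤hi j)) (ℕₚ.<-trans gt apart))

  depth-< : ∀ {i j} → i ∈ js → j ⊏ i → depth i < depth j
  depth-< {i} {j} i∈ j⊏i = count-< (i ⊏?_) (j ⊏?_) (λ _ → ⊏-trans j⊏i) i∈ j⊏i (λ { (lt , _) → ℕₚ.<-irrefl refl lt })

  chosen : List (Fin k)
  chosen = filter (λ i → depth i % K ℕₚ.≟ r) js

  chosen⊆ : ∀ {i} → i ∈ chosen → i ∈ js
  chosen⊆ i∈ = proj₁ (∈-filter⁻ (λ i → depth i % K ℕₚ.≟ r) {xs = js} i∈)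

  depth-level : ∀ {i} → i ∈ chosen → depth i ≡ r + level i * K
  depth-level {i} i∈ = trans (m≡m%n+[m/n]*n (depth i) K)
    (cong (_+ level i * K) (proj₂ (∈-filter⁻ (λ i → depth i % K ℕₚ.≟ r) {xs = js} i∈)))

  level-< : ∀ {i j} → i ∈ chosen → j ∈ chosen → j ⊏ i → level i < level j
  level-< {i} {j} i∈ j∈ j⊏i = ℕₚ.*-cancelʳ-< K _ _ (ℕₚ.+-cancelˡ-< r _ _
    (subst₂ _<_ (depth-level i∈) (depth-level j∈) (depth-< (chosen⊆ i∈) j⊏i)))

  -- Depths of chosen arcs are congruent mod `K`, so their difference is exactly `K` times the
  -- difference of levels.
  gap-between : ∀ {i j} → i ∈ chosen → j ∈ chosen → j ⊏ i → (level j ∸ level i) * K ≤ suc (count (between? j i) js)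
  gap-between {i} {j} i∈ j∈ j⊏i = ℕₚ.+-cancelʳ-≤ (r + level i * K) _ _ (begin
    gap * K + (r + level i * K)                     ≡⟨ +-exchange (gap * K) r (level i * K) ⟩
    r + (gap * K + level i * K)                     ≡⟨ cong (r +_) (sym (ℕₚ.*-distribʳ-+ K gap (level i))) ⟩
    r + (gap + level i) * K                         ≡⟨ cong (λ x → r + x * K) (ℕₚ.m∸n+n≡m (ℕₚ.<⇒≤ (level-< i∈ j∈ j⊏i))) ⟩
    r + level j * K                                 ≡⟨ sym (depth-level j∈) ⟩
    depth j                                         ≤⟨ depth-between (chosen⊆ i∈) j⊏i ⟩
    count (between? j i) js + suc (depth i)         ≡⟨ ℕₚ.+-suc _ (depth i) ⟩
    suc (count (between? j i) js) + depth i         ≡⟨ cong (suc (count (between? j i) js) +_) (depth-level i∈) ⟩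
    suc (count (between? j i) js) + (r + level i * K) ∎)
    where
    open ℕₚ.≤-Reasoning
    gap : ℕ
    gap = level j ∸ level i

module Rerouting {G : Graph} (connected : Graph.Connected G) (emb : SphereEmbedding G) (Z : Cycle G)
  (D : Subset (SphereEmbedding.f emb)) (disc : SphereEmbedding.IsDiscBoundedBy emb Z D) where
  open Graph G
  open SphereEmbedding emb
  open Sweep connected emb Z D disc public

  record Routed (P : List Vertex) : Set where
    field
      lo hi : ℕ
      lo≤hi : lo ≤ hi
      hi<ℓ  : hi < ℓ
      walk  : Star (AdjIn (_∈ P)) (src (z lo)) (src (z hi))
      lo∈   : src (z lo) ∈ P
      hi∈   : src (z hi) ∈ P
    lo<ℓ : lo < ℓ
    lo<ℓ = ℕₚ.≤-<-trans lo≤hi hi<ℓ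

  AdjIn-sym : ∀ {P u v} → AdjIn P u v → AdjIn P v u
  AdjIn-sym (d , p , q , pu , pv) = rev d , q , trans (tgt-rev d) p , pv , pu

  ChordIn-sym : ∀ {vs β u v} → ChordIn vs β u v → ChordIn vs β v u
  ChordIn-sym c = record
    { chord = record { out = into ; into = out ; out-at = into-at ; into-at = out-at ; same-face = sym same-face }
    ; start = end ; end = start ; on = trans (cong (Vec.lookup D) (sym same-face)) on }
    where
    open ChordIn c
    open Chord chord

  ChordIn-⊆ : ∀ {vs ws β u v} → (∀ {x} → x ∈ vs → x ∈ ws) → ChordIn vs β u v → ChordIn ws β u v
  ChordIn-⊆ sub c = record { chord = chord ; start = sub start ; end = sub end ; on = on }
    where open ChordIn c

  -- Face distance outside the disc

  Share : Vertex → Vertex → Set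
  Share u v = ∃ λ d → ∃ λ e → face d ≡ face e × inD d ≡ false × src d ≡ u × src e ≡ v

  share? : ∀ u v → Dec (Share u v)
  share? u v = anyDart? (λ d → anyDart? (λ e → (face d Finₚ.≟ face e) ×-dec (inD d 𝔹.≟ false) ×-dec (src d Finₚ.≟ u) ×-dec (src e Finₚ.≟ v)))

  Outer : ℕ → Vertex → Vertex → Set
  Outer zero    u v = u ≡ v
  Outer (suc g) u v = Outer g u v ⊎ (∃ λ w → Outer g u w × Share w v)

  outer? : ∀ g u v → Dec (Outer g u v)
  outer? zero    u v = u Finₚ.≟ v
  outer? (suc g) u v = outer? g u v ⊎-dec Finₚ.any? (λ w → outer? g u w ×-dec share? w v)

  outer-mono : ∀ {g h u v} → g ≤ h → Outer g u v → Outer h u v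
  outer-mono {h = zero}  z≤n o = o
  outer-mono {zero} {suc h} z≤n o = inj₁ (outer-mono {h = h} z≤n o)
  outer-mono {suc g} {suc h} (s≤s p) (inj₁ o) = inj₁ (outer-mono p o)
  outer-mono {suc g} {suc h} (s≤s p) (inj₂ (w , o , s)) = inj₂ (w , outer-mono p o , s)

  outer-curve : ∀ g {u v} → Outer g u v → ∃ λ qs → length qs ≤ suc g × u ∈ qs × v ∈ qs × Star (ChordIn qs false) u v
  outer-curve zero {u} refl = u ∷ [] , ℕₚ.≤-refl , here refl , here refl , ε
  outer-curve (suc g) (inj₁ o) = let qs , len , u∈ , v∈ , γ = outer-curve g o in qs , ℕₚ.m≤n⇒m≤1+n len , u∈ , v∈ , γ
  outer-curve (suc g) {u} {v} (inj₂ (w , o , d , e , same , out , refl , refl)) =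
    let qs , len , u∈ , w∈ , γ = outer-curve g o in
    src e ∷ qs , s≤s len , there u∈ , here refl
    , gmap id (ChordIn-⊆ there) γ ◅◅ (record
        { chord = record { out = d ; into = e ; out-at = refl ; into-at = refl ; same-face = same }
        ; start = there w∈ ; end = here refl ; on = out } ◅ ε)

  outer-incident : ∀ g {u v} → Outer g u v → u ≡ v ⊎ (∃ λ e → src e ≡ v × inD e ≡ false)
  outer-incident zero    eq = inj₁ eq
  outer-incident (suc g) (inj₁ o) = outer-incident g o
  outer-incident (suc g) (inj₂ (_ , _ , d , e , same , out , _ , at)) = inj₂ (e , at , trans (cong (Vec.lookup D) (sym same)) out)

  crossing : ∀ {P Q vs ws i j a b} → i ≤ j → j ≤ ℓ → i ≤ a → a < j → b < ℓ → b < i ⊎ j ≤ b →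
    Star (AdjIn P) (src (z i)) (src (z j)) → Star (ChordIn vs true) (src (z i)) (src (z j)) →
    Star (AdjIn Q) (src (z a)) (src (z b)) → Star (ChordIn ws true) (src (z a)) (src (z b)) →
    Q (src (z a)) → Q (src (z b)) →
    (∀ {x} → P x → ¬ Q x) → (∀ {x} → Q x → x ∉ vs) → (∀ {x} → x ∈ ws → ¬ P x) → ⊥
  crossing {i = i} {j} i≤j with j ∸ i | ℕₚ.m∸n+n≡m i≤j
  ... | k | refl = crossing-curves-meet i k

  separated : ∀ {P qs rs i j a b} → i ≤ j → j ≤ ℓ → i ≤ a → a < j → b < ℓ → b < i ⊎ j ≤ b →
    Star (ChordIn qs false) (src (z i)) (src (z j)) → Star (ChordIn rs true) (src (z i)) (src (z j)) →
    Star (AdjIn P) (src (z a)) (src (z b)) → P (src (z a)) → P (src (z b)) →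
    (∀ {x} → P x → x ∉ qs) → (∀ {x} → P x → x ∉ rs) → ⊥
  separated {i = i} {j} i≤j with j ∸ i | ℕₚ.m∸n+n≡m i≤j
  ... | k | refl = separated-path-meets i k

  module Reroute (ρ : ℕ)
    (inner : ∀ {p q} → p < ℓ → q < ℓ → ∃ λ rs → length rs ≤ ρ × src (z p) ∈ rs × Star (ChordIn rs true) (src (z p)) (src (z q)))
    {k : ℕ} (path : Fin k → List Vertex) (routed : ∀ i → Routed (path i))
    (disjoint : ∀ {i j} → i ≢ j → Disjoint (path i) (path j)) where

    open module R i = Routed (routed i) using (lo; hi; lo≤hi; hi<ℓ; lo<ℓ; walk; lo∈; hi∈)

    chords : Fin k → List Vertex
    chords i = proj₁ (inner (lo<ℓ i) (hi<ℓ i))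

    chord-curve : ∀ i → Star (ChordIn (chords i) true) (src (z (lo i))) (src (z (hi i)))
    chord-curve i = proj₂ (proj₂ (proj₂ (inner (lo<ℓ i) (hi<ℓ i))))

    infix 4 _∈?_
    _∈?_ : ∀ (x : Vertex) xs → Dec (x ∈ xs)
    x ∈? xs = Any.any? (x Finₚ.≟_) xs

    Meets : Fin k → Fin k → Set
    Meets i j = Any.Any (_∈ chords j) (path i)

    meets? : ∀ i j → Dec (Meets i j)
    meets? i j = Any.any? (_∈? chords j) (path i)

    -- The paths are disjoint, so at most `ρ` of them pass through the inner curve of `j`. Only
    -- in-degrees are bounded this way, as a single path may meet many curves.
    indegree : ∀ j → count (λ i → meets? i j) (allFin k) ≤ ρ
    indegree j = ℕₚ.≤-trans
      (hitting-bound path disjoint (chords j) (Uniqueₚ.filter⁺ (λ i → meets? i j) (Uniqueₚ.allFin⁺ k))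
        (λ i∈ → find (proj₂ (∈-filter⁻ (λ i → meets? i j) {xs = allFin k} i∈))))
      (proj₁ (proj₂ (inner (lo<ℓ j) (hi<ℓ j))))

    meets-refl : ∀ i → Meets i i
    meets-refl i = lose (lo∈ i) (proj₁ (proj₂ (proj₂ (inner (lo<ℓ i) (hi<ℓ i)))))

    abstract
      family : ∃ λ js → (∀ {j} → j ∈ js → j ∈ allFin k) × AllPairs (λ i j → ¬ Meets i j × ¬ Meets j i) js
        × length (allFin k) ≤ length js * (ρ + ρ)
      family = independent meets? (allFin k) meets-refl indegree

    js : List (Fin k)
    js = proj₁ family

    js-unique : Unique js
    js-unique = AllPairs.map (λ { (¬m , _) refl → ¬m (meets-refl _) }) (proj₁ (proj₂ (proj₂ family)))

    js-size : k ≤ length js * (ρ + ρ)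
    js-size = subst (_≤ length js * (ρ + ρ)) (Listₚ.length-tabulate id) (proj₂ (proj₂ (proj₂ family)))

    apart : ∀ {i j p q} → i ≢ j → src (z p) ∈ path i → src (z q) ∈ path j → p ≢ q
    apart i≢j p∈ q∈ refl = disjoint i≢j (p∈ , q∈)

    -- `crossing` excludes the interleaved order, and disjointness of the paths excludes equal ends.
    ordered : ∀ {i j} → i ≢ j → ¬ Meets i j → ¬ Meets j i → lo i < lo j → (lo i < lo j × hi j < hi i) ⊎ hi i < lo j
    ordered {i} {j} i≢j ¬ij ¬ji lt with ℕₚ.<-cmp (hi i) (lo j) | ℕₚ.<-cmp (hi j) (hi i)
    ... | tri< p _ _ | _          = inj₂ p
    ... | tri≈ _ p _ | _          = ⊥-elim (apart i≢j (hi∈ i) (lo∈ j) p)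
    ... | tri> _ _ _ | tri< p _ _ = inj₁ (lt , p)
    ... | tri> _ _ _ | tri≈ _ p _ = ⊥-elim (apart i≢j (hi∈ i) (hi∈ j) (sym p))
    ... | tri> _ _ p | tri> _ _ q = ⊥-elim (crossing (lo≤hi i) (ℕₚ.<⇒≤ (hi<ℓ i)) (ℕₚ.<⇒≤ lt) p (hi<ℓ j) (inj₂ (ℕₚ.<⇒≤ q))
            (walk i) (chord-curve i) (walk j) (chord-curve j) (lo∈ j) (hi∈ j)
            (λ x∈i x∈j → disjoint i≢j (x∈i , x∈j)) (λ x∈j x∈ → ¬ji (lose x∈j x∈)) (λ x∈ x∈i → ¬ij (lose x∈i x∈)))

    laminar : ∀ {i j} → i ∈ js → j ∈ js → i ≢ j → (lo j < lo i × hi i < hi j) ⊎ (lo i < lo j × hi j < hi i) ⊎ hi i < lo j ⊎ hi j < lo i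
    laminar {i} {j} i∈ j∈ i≢j with ℕₚ.<-cmp (lo i) (lo j) | avoid (AllPairs-lookup (proj₁ (proj₂ (proj₂ family))) i∈ j∈ i≢j)
      where
      avoid : (¬ Meets i j × ¬ Meets j i) ⊎ (¬ Meets j i × ¬ Meets i j) → ¬ Meets i j × ¬ Meets j i
      avoid (inj₁ p)       = p
      avoid (inj₂ (p , q)) = q , p
    ... | tri≈ _ p _  | _         = ⊥-elim (apart i≢j (lo∈ i) (lo∈ j) p)
    ... | tri< lt _ _ | ¬ij , ¬ji with ordered i≢j ¬ij ¬ji lt
    ...   | inj₁ p = inj₂ (inj₁ p)
    ...   | inj₂ p = inj₂ (inj₂ (inj₁ p))
    laminar {i} {j} i∈ j∈ i≢j | tri> _ _ gt | ¬ij , ¬ji with ordered (i≢j ∘ sym) ¬ji ¬ij gt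
    ...   | inj₁ p = inj₁ p
    ...   | inj₂ p = inj₂ (inj₂ (inj₂ p))

    K : ℕ
    K = 6 + ρ

    private
      module Nest = Nesting lo hi lo≤hi js js-unique laminar K

    abstract
      residue : ∃ λ r → length js ≤ K * length (Nest.chosen r)
      -- Depths are the same for every residue, so they are taken at `0` before the popular residue
      -- is known.
      residue = popular-value K (λ i → Nest.depth 0 i % K) js (λ {i} _ → m%n<n (Nest.depth 0 i) K)

    open Nesting lo hi lo≤hi js js-unique laminar K (proj₁ residue) public

    -- The outer curve from `p` to `q` and the inner curve back form a closed curve. An arc `c`
    -- between `j` and `i` surrounds `p` but not `q`, so exactly one of its ends lies between them
    -- on `Z` and its path must hit the closed curve.
    between-bound : ∀ {i j p q qs} → lo j ≤ p → p ≤ hi j → q < ℓ → q ≤ lo i ⊎ hi i ≤ q →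
      Star (ChordIn qs false) (src (z p)) (src (z q)) → count (between? j i) js ≤ length qs + ρ
    between-bound {i} {j} {p} {q} {qs} lo≤p p≤hi q<ℓ q-out γ =
      let rs , len , _ , δ = inner p<ℓ q<ℓ in
      ℕₚ.≤-trans (hitting-bound path disjoint (qs ++ rs) (Uniqueₚ.filter⁺ (between? j i) js-unique)
          (λ {c} c∈ → hit c (proj₂ (∈-filter⁻ (between? j i) {xs = js} c∈)) δ))
        (subst (_≤ length qs + ρ) (sym (Listₚ.length-++ qs)) (ℕₚ.+-monoʳ-≤ (length qs) len))
      where
      p<ℓ : p < ℓ
      p<ℓ = ℕₚ.≤-<-trans p≤hi (hi<ℓ j)
      cut : ∀ {rs} c → Between j i c → Star (ChordIn rs true) (src (z p)) (src (z q)) → q ≤ lo i ⊎ hi i ≤ q →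
        (∀ {x} → x ∈ path c → x ∉ qs) → (∀ {x} → x ∈ path c → x ∉ rs) → ⊥
      cut c ((c<j , j<c) , (i<c , c<i)) δ (inj₁ q≤) =
        separated (ℕₚ.<⇒≤ (ℕₚ.<-trans q<c c<p)) (ℕₚ.<⇒≤ p<ℓ) (ℕₚ.<⇒≤ q<c) c<p (hi<ℓ c) (inj₂ (ℕₚ.<⇒≤ (ℕₚ.≤-<-trans p≤hi j<c)))
          (reverse ChordIn-sym γ) (reverse ChordIn-sym δ) (walk c) (lo∈ c) (hi∈ c)
        where
        q<c : q < lo c
        q<c = ℕₚ.≤-<-trans q≤ i<c
        c<p : lo c < p
        c<p = ℕₚ.<-≤-trans c<j lo≤p
      cut c ((c<j , j<c) , (i<c , c<i)) δ (inj₂ ≤q) =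
        separated (ℕₚ.<⇒≤ (ℕₚ.<-trans p<c c<q)) (ℕₚ.<⇒≤ q<ℓ) (ℕₚ.<⇒≤ p<c) c<q (lo<ℓ c) (inj₁ (ℕₚ.<-≤-trans c<j lo≤p))
          γ δ (reverse AdjIn-sym (walk c)) (hi∈ c) (lo∈ c)
        where
        p<c : p < hi c
        p<c = ℕₚ.≤-<-trans p≤hi j<c
        c<q : hi c < q
        c<q = ℕₚ.<-≤-trans c<i ≤q
      hit : ∀ {rs} c → Between j i c → Star (ChordIn rs true) (src (z p)) (src (z q)) → ∃ λ v → v ∈ path c × v ∈ qs ++ rs
      hit {rs} c btw δ with Any.any? (_∈? (qs ++ rs)) (path c)
      ... | yes found = find found
      ... | no none = ⊥-elim (cut c btw δ q-out (λ x∈ x∈q → none (lose x∈ (∈-++⁺ˡ x∈q))) (λ x∈ x∈r → none (lose x∈ (∈-++⁺ʳ qs x∈r))))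

    -- This fixes `K`. The bound on `h` is two outer curves with `g + 1` vertices each; at `g = 1`
    -- it allows `suc (h + ρ) = 5 + ρ`, and `6 + ρ` is the least value beyond it. Larger `g` only
    -- adds slack.
    tight : ∀ g h → 0 < g → h ≤ g + g + 2 → ¬ (g * K ≤ suc (h + ρ))
    tight (suc g) h _ h≤ le = ℕₚ.<⇒≱ (begin-strict
      suc (h + ρ)                            ≤⟨ s≤s (ℕₚ.+-monoˡ-≤ ρ h≤) ⟩
      suc ((suc g + suc g + 2) + ρ)          <⟨ s≤s (s≤s (ℕₚ.≤-reflexive (regroup g ρ))) ⟩
      (6 + ρ) + (g + g)                      ≤⟨ ℕₚ.+-monoʳ-≤ (6 + ρ) (ℕₚ.≤-trans (ℕₚ.≤-reflexive (double g)) (ℕₚ.*-monoʳ-≤ g {2} {K} (s≤s (s≤s z≤n)))) ⟩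
      suc g * K                              ∎) le
      where
      open ℕₚ.≤-Reasoning
      open +-*-Solver
      double : ∀ g → g + g ≡ g * 2
      double = solve 1 (λ g → g :+ g := g :* con 2) refl
      regroup : ∀ g ρ → suc g + suc g + 2 + ρ ≡ 4 + ρ + (g + g)
      regroup = solve 2 (λ g ρ → con 1 :+ g :+ (con 1 :+ g) :+ con 2 :+ ρ := con 4 :+ ρ :+ (g :+ g)) refl

    infix 4 _⊑_
    _⊑_ : Fin k → Fin k → Set
    j ⊑ i = j ≡ i ⊎ j ⊏ i

    -- X i is the closed region swept out by i: the vertices at face distance at most g, outside the disc,
    -- from the arc of a chosen j nested g levels inside i.
    Below : Fin k → Vertex → Fin k → Set
    Below i v j = j ⊑ i × ∃ λ (p : Fin ℓ) → lo j ≤ Fin.toℕ p × Fin.toℕ p ≤ hi j × Outer (level j ∸ level i) (src (z (Fin.toℕ p))) v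

    -- `Y i` collects the regions of the chosen arcs strictly inside `i`, and `W i`, the frontier,
    -- carries the new route of `i`.
    X Y W : Fin k → Vertex → Set
    X i v = Any.Any (Below i v) chosen
    Y i v = Any.Any (λ j → j ⊏ i × X j v) chosen
    W i v = X i v × ¬ Y i v

    below? : ∀ i v j → Dec (Below i v j)
    below? i v j = ((j Finₚ.≟ i) ⊎-dec (j ⊏? i)) ×-dec
      Finₚ.any? (λ p → (lo j ℕₚ.≤? Fin.toℕ p) ×-dec (Fin.toℕ p ℕₚ.≤? hi j) ×-dec outer? (level j ∸ level i) (src (z (Fin.toℕ p))) v)

    abstract
      X? : ∀ i v → Dec (X i v)
      X? i v = Any.any? (below? i v) chosen

      Y? : ∀ i v → Dec (Y i v)
      Y? i v = Any.any? (λ j → (j ⊏? i) ×-dec X? j v) chosen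

    ⊑-⊏-trans : ∀ {i j l} → i ⊑ j → j ⊏ l → i ⊏ l
    ⊑-⊏-trans (inj₁ refl) q = q
    ⊑-⊏-trans (inj₂ p)    q = ⊏-trans p q

    level-≤ : ∀ {i j} → i ∈ chosen → j ∈ chosen → j ⊑ i → level i ≤ level j
    level-≤ i∈ j∈ (inj₁ refl) = ℕₚ.≤-refl
    level-≤ i∈ j∈ (inj₂ j⊏i)  = ℕₚ.<⇒≤ (level-< i∈ j∈ j⊏i)

    arc⊆X : ∀ {i} → i ∈ chosen → ∀ p → lo i ≤ p → p ≤ hi i → X i (src (z p))
    arc⊆X {i} i∈ p lo≤ ≤hi = lose i∈ (inj₁ refl , Fin.fromℕ< p<ℓ
      , subst (lo i ≤_) (sym eq) lo≤ , subst (_≤ hi i) (sym eq) ≤hi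
      , outer-mono {0} z≤n (cong (src ∘ z) eq))
      where
      p<ℓ : p < ℓ
      p<ℓ = ℕₚ.≤-<-trans ≤hi (hi<ℓ i)
      eq : Fin.toℕ (Fin.fromℕ< p<ℓ) ≡ p
      eq = Finₚ.toℕ-fromℕ< p<ℓ

    gap-suc : ∀ {i j l} → i ∈ chosen → j ∈ chosen → l ∈ chosen → l ⊑ j → j ⊏ i → suc (level l ∸ level j) ≤ level l ∸ level i
    gap-suc {i} {j} {l} i∈ j∈ l∈ l⊑j j⊏i = ℕₚ.∸-monoʳ-< (level-< i∈ j∈ j⊏i) (level-≤ j∈ l∈ l⊑j)

    -- Seen from `i` the arc `l` is at least one level deeper than seen from `j`, which pays for one
    -- more chord.
    Y-neighbours : ∀ {i u v} → i ∈ chosen → Y i u → Share u v → X i v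
    Y-neighbours i∈ y share with find y
    ... | j , j∈ , j⊏i , x with find x
    ...   | l , l∈ , l⊑j , p , lo≤ , ≤hi , o = lose l∈ (inj₂ (⊑-⊏-trans l⊑j j⊏i) , p , lo≤ , ≤hi
            , outer-mono (gap-suc i∈ j∈ l∈ l⊑j j⊏i) (inj₂ (_ , o , share)))

    -- Otherwise the outer curve from the arc of `l` leaves the arc of `i`, crosses all arcs between
    -- them, and is too short for that by `tight`.
    Y-arc : ∀ {i} → i ∈ chosen → ∀ q → q < ℓ → Y i (src (z q)) → lo i < q × q < hi i
    Y-arc {i} i∈ q q< y with find y
    ... | j , j∈ , j⊏i , x with find x
    ...   | l , l∈ , l⊑j , p , lo≤ , ≤hi , o = inside (lo i ℕₚ.<? q) (q ℕₚ.<? hi i)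
      where
      impossible : q ≤ lo i ⊎ hi i ≤ q → ⊥
      impossible out =
        let qs , len , _ , _ , γ = outer-curve (level l ∸ level j) o
            gap = gap-suc i∈ j∈ l∈ l⊑j j⊏i
        in tight (level l ∸ level i) (length qs) (ℕₚ.≤-<-trans z≤n gap)
             (ℕₚ.≤-trans len (ℕₚ.≤-trans gap (ℕₚ.≤-trans (ℕₚ.m≤m+n _ _) (ℕₚ.m≤m+n _ 2))))
             (ℕₚ.≤-trans (gap-between i∈ l∈ (⊑-⊏-trans l⊑j j⊏i)) (s≤s (between-bound lo≤ ≤hi q< out γ)))
      inside : Dec (lo i < q) → Dec (q < hi i) → lo i < q × q < hi i
      inside (yes p) (yes q) = p , q
      inside (no ≮)  _       = ⊥-elim (impossible (inj₁ (ℕₚ.≮⇒≥ ≮)))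
      inside (yes _) (no ≮)  = ⊥-elim (impossible (inj₂ (ℕₚ.≮⇒≥ ≮)))

    no-shortcut : ∀ {i j p q g qs} → i ∈ chosen → j ∈ chosen → j ⊑ i → lo j ≤ p → p ≤ hi j → q < ℓ → q ≤ lo i ⊎ hi i ≤ q →
      Star (ChordIn qs false) (src (z p)) (src (z q)) → length qs ≤ suc (level j ∸ level i) + suc g → g ≤ level j ∸ level i → 0 < level j ∸ level i → ⊥
    no-shortcut {i} i∈ j∈ (inj₁ refl) _ _ _ _ _ _ _ pos = ℕₚ.<-irrefl (sym (ℕₚ.n∸n≡0 (level i))) pos
    no-shortcut {i} {j} {g = g} {qs} i∈ j∈ (inj₂ j⊏i) lo≤ ≤hi q< out γ len g≤ pos =
      tight (level j ∸ level i) (length qs) pos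
        (ℕₚ.≤-trans len (ℕₚ.≤-trans (ℕₚ.+-monoʳ-≤ (suc gap) (s≤s g≤)) (ℕₚ.≤-reflexive shape)))
        (ℕₚ.≤-trans (gap-between i∈ j∈ j⊏i) (s≤s (between-bound lo≤ ≤hi q< out γ)))
      where
      gap : ℕ
      gap = level j ∸ level i
      shape : suc gap + suc gap ≡ gap + gap + 2
      shape = trans (cong suc (ℕₚ.+-suc gap gap)) (ℕₚ.+-comm 2 (gap + gap))

    ⊑-within : ∀ {i j} → j ⊑ i → lo i ≤ lo j × hi j ≤ hi i
    ⊑-within (inj₁ refl)     = ℕₚ.≤-refl , ℕₚ.≤-refl
    ⊑-within (inj₂ (p , q)) = ℕₚ.<⇒≤ p , ℕₚ.<⇒≤ q

    -- The outer curves from both arcs to the common vertex are joined, and the result is charged to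
    -- the arc with the larger gap, so that it has at most `2 * gap + 2` vertices. If both gaps are
    -- 0, the vertex itself lies on both arcs.
    X-disjoint : ∀ {i j v} → i ∈ chosen → j ∈ chosen → hi i < lo j → X i v → X j v → ⊥
    X-disjoint {i} {j} {v} i∈ j∈ before xi xj with find xi | find xj
    ... | a , a∈ , a⊑i , p , lo≤p , p≤hi , o | b , b∈ , b⊑j , q , lo≤q , q≤hi , o′ =
      compare (ℕₚ.≤-total g′ g) (g ℕₚ.≟ 0) (g′ ℕₚ.≟ 0)
      where
      g g′ : ℕ
      g  = level a ∸ level i
      g′ = level b ∸ level j
      p≤ : Fin.toℕ p ≤ hi i
      p≤ = ℕₚ.≤-trans p≤hi (proj₂ (⊑-within a⊑i))
      ≤q : lo j ≤ Fin.toℕ q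
      ≤q = ℕₚ.≤-trans (proj₁ (⊑-within b⊑j)) lo≤q
      curve : ∃ λ ts → length ts ≤ suc g + suc g′ × Star (ChordIn ts false) (src (z (Fin.toℕ p))) (src (z (Fin.toℕ q)))
      curve =
        let qs , len , _ , _ , γ = outer-curve g o
            rs , len′ , _ , _ , δ = outer-curve g′ o′
        in qs ++ rs , subst (_≤ suc g + suc g′) (sym (Listₚ.length-++ qs)) (ℕₚ.+-mono-≤ len len′)
         , gmap id (ChordIn-⊆ ∈-++⁺ˡ) γ ◅◅ reverse ChordIn-sym (gmap id (ChordIn-⊆ (∈-++⁺ʳ qs)) δ)
      both-zero : g ≡ 0 → g′ ≡ 0 → ⊥
      both-zero eq eq′ = ℕₚ.<⇒≱ before (ℕₚ.≤-trans ≤q (subst (_≤ hi i) same p≤))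
        where
        same : Fin.toℕ p ≡ Fin.toℕ q
        same = z-injective (Finₚ.toℕ<n p) (Finₚ.toℕ<n q)
          (trans (subst (λ g → Outer g (src (z (Fin.toℕ p))) v) eq o) (sym (subst (λ g → Outer g (src (z (Fin.toℕ q))) v) eq′ o′)))
      compare : g′ ≤ g ⊎ g ≤ g′ → Dec (g ≡ 0) → Dec (g′ ≡ 0) → ⊥
      compare (inj₁ g′≤g) (yes g≡0) _ = both-zero g≡0 (ℕₚ.n≤0⇒n≡0 (subst (g′ ≤_) g≡0 g′≤g))
      compare (inj₂ g≤g′) _ (yes g′≡0) = both-zero (ℕₚ.n≤0⇒n≡0 (subst (g ≤_) g′≡0 g≤g′)) g′≡0
      compare (inj₁ g′≤g) (no ≢0) _ = let ts , len , γ = curve in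
        no-shortcut i∈ a∈ a⊑i lo≤p p≤hi (Finₚ.toℕ<n q) (inj₂ (ℕₚ.<⇒≤ (ℕₚ.<-≤-trans before ≤q))) γ len g′≤g (ℕₚ.n≢0⇒n>0 ≢0)
      compare (inj₂ g≤g′) _ (no ≢0) = let ts , len , γ = curve in
        no-shortcut j∈ b∈ b⊑j lo≤q q≤hi (Finₚ.toℕ<n p) (inj₁ (ℕₚ.<⇒≤ (ℕₚ.≤-<-trans p≤ before)))
          (reverse ChordIn-sym γ) (subst (length ts ≤_) (ℕₚ.+-comm (suc g) (suc g′)) len) g≤g′ (ℕₚ.n≢0⇒n>0 ≢0)

    -- For nested arcs the inner region is part of the `Y` that the outer frontier leaves out; arcs
    -- side by side have disjoint regions.
    W-disjoint : ∀ {i j v} → i ∈ chosen → j ∈ chosen → i ≢ j → W i v → W j v → ⊥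
    W-disjoint i∈ j∈ i≢j (xi , ¬yi) (xj , ¬yj) with laminar (chosen⊆ i∈) (chosen⊆ j∈) i≢j
    ... | inj₁ i⊏j               = ¬yj (lose i∈ (i⊏j , xi))
    ... | inj₂ (inj₁ j⊏i)        = ¬yi (lose j∈ (j⊏i , xj))
    ... | inj₂ (inj₂ (inj₁ lt))  = X-disjoint i∈ j∈ lt xi xj
    ... | inj₂ (inj₂ (inj₂ lt))  = X-disjoint j∈ i∈ lt xj xi

    X-kept : ∀ {i v} → X i v → Subgraph.keepV (emptyDisc Z D) v
    X-kept {i} x with find x
    ... | j , _ , _ , p , _ , _ , o with outer-incident (level j ∸ level i) o
    ...   | inj₁ refl = inj₁ (z∈Z (ℕₚ.<⇒≤ (Finₚ.toℕ<n p)))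
    ...   | inj₂ (e , at , out) = outside e at out

    edge-kept : ∀ d → inD d ≡ false ⊎ inD (rev d) ≡ false → Subgraph.keepE (emptyDisc Z D) (edge d)
    edge-kept d out with onZ? d
    ... | yes on = inj₁ on
    ... | no off = inj₂ λ { (a , same , in-a) → not-fixed (Vecₚ.[]=⇒lookup in-a) (clear (same-edge {d = a} {d} same) both) }
      where
      both : inD d ≡ false
      both = Sum.[ id , (λ p → trans (sym (inD-off d off)) p) ]′ out
      clear : ∀ {a} → a ≡ d ⊎ a ≡ rev d → inD d ≡ false → inD a ≡ false
      clear (inj₁ refl) p = p
      clear (inj₂ refl) p = trans (inD-off d off) p

    -- `S` is the component of `t` in `W i` along edges with an outer side. By `arc-ends-agree` it
    -- contains both ends of the arc or neither, and `t` is one of them.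
    connect : ∀ {i} → i ∈ chosen → ∀ {s t} → (s ≡ src (z (lo i)) × t ≡ src (z (hi i))) ⊎ (s ≡ src (z (hi i)) × t ≡ src (z (lo i))) →
      ∃ λ p → Routing.IsPath (emptyDisc Z D) s t p × (∀ {x} → x ∈ p → W i x)
    connect {i} i∈ {s} {t} ends =
      let p , h , l , u , sub , lk = path-to grown s-visited in
      p , record { starts = h ; ends = l ; inside = All.tabulate (λ x∈ → X-kept (proj₁ (visited-W grown (sub x∈))))
                 ; adjacent = Linked.map (λ { (d , (out , _ , _) , refl , refl) → rev d , edge-kept d out , refl , tgt-rev d }) lk
                 ; simple = u }
        , visited-W grown ∘ sub
      where
      end-W : ∀ p → lo i ≤ p → p ≤ hi i → ¬ (lo i < p × p < hi i) → W i (src (z p))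
      end-W p lo≤ ≤hi not-inside = arc⊆X i∈ p lo≤ ≤hi , λ y → not-inside (Y-arc i∈ p (ℕₚ.≤-<-trans ≤hi (hi<ℓ i)) y)
      lo-W : W i (src (z (lo i)))
      lo-W = end-W (lo i) ℕₚ.≤-refl (lo≤hi i) (λ { (p , _) → ℕₚ.<-irrefl refl p })
      hi-W : W i (src (z (hi i)))
      hi-W = end-W (hi i) (lo≤hi i) ℕₚ.≤-refl (λ { (_ , p) → ℕₚ.<-irrefl refl p })
      t-W : W i t
      t-W = Sum.[ (λ { (_ , refl) → hi-W }) , (λ { (_ , refl) → lo-W }) ]′ ends
      W? : ∀ v → Dec (W i v)
      W? v = X? i v ×-dec ¬? (Y? i v)
      Allowed : Dart → Set
      Allowed d = (inD d ≡ false ⊎ inD (rev d) ≡ false) × W i (src d) × W i (tgt d)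
      -- Rooted at `t`, because `path-to` leads from a visited vertex to the root.
      open Growth src {Allowed} (λ d → ((inD d 𝔹.≟ false) ⊎-dec (inD (rev d) 𝔹.≟ false)) ×-dec W? (src d) ×-dec W? (tgt d)) t
        renaming (_∈?_ to _∈?′_)
      ds : List Dart
      ds = proj₁ growth
      grown : Grown ds
      grown = proj₁ (proj₂ growth)
      visited-W : ∀ {ds} → Grown ds → ∀ {v} → v ∈ visited ds → W i v
      visited-W [] (here refl) = t-W
      visited-W (grow (_ , _ , w) _ _ _) (here refl) = w
      visited-W (grow _ _ _ g) (there v∈) = visited-W g v∈
      S Xᵇ Yᵇ : Vertex → Bool
      S v = does (v ∈?′ visited ds)
      Xᵇ v = does (X? i v)
      Yᵇ v = does (Y? i v)
      does⁺ : ∀ {P : Set} (P? : Dec P) → P → does P? ≡ true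
      does⁺ (yes _) _ = refl
      does⁺ (no ¬p) p = ⊥-elim (¬p p)
      does⁻ : ∀ {P : Set} (P? : Dec P) → does P? ≡ true → P
      does⁻ (yes p) _ = p
      does-no : ∀ {P : Set} (P? : Dec P) → ¬ P → does P? ≡ false
      does-no (yes p) ¬p = ⊥-elim (¬p p)
      does-no (no _)  _  = refl
      does-no⁻ : ∀ {P : Set} (P? : Dec P) → does P? ≡ false → ¬ P
      does-no⁻ (no ¬p) _ = ¬p
      agree : S (src (z (lo i))) ≡ S (src (z (hi i)))
      agree = arc-ends-agree Xᵇ Yᵇ S (lo i) (hi i) (lo≤hi i) (hi<ℓ i)
        (λ v s → does-no (Y? i v) (proj₂ (visited-W grown (does⁻ (v ∈?′ visited ds) s))))
        (λ d e same out y → does⁺ (X? i (src e)) (Y-neighbours i∈ (does⁻ (Y? i (src d)) y) (d , e , same , out , refl , refl)))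
        (λ d out s x y → let s∈ = does⁻ (src d ∈?′ visited ds) s in
          does⁺ (tgt d ∈?′ visited ds) (proj₂ (proj₂ growth) d
            (out , visited-W grown s∈ , does⁻ (X? i (tgt d)) x , does-no⁻ (Y? i (tgt d)) y) s∈))
        (λ p lo≤ ≤hi → does⁺ (X? i (src (z p))) (arc⊆X i∈ p lo≤ ≤hi))
        (λ q q< y → Y-arc i∈ q q< (does⁻ (Y? i (src (z q))) y))
      s-visited : s ∈ visited ds
      s-visited = does⁻ (s ∈?′ visited ds) (Sum.[ (λ { (refl , refl) → trans agree t-in }) , (λ { (refl , refl) → trans (sym agree) t-in }) ]′ ends)
        where
        t-in : S t ≡ true
        t-in = does⁺ (t ∈?′ visited ds) (root∈visited ds)

-- Inner curves through `C`, and given paths as arcs of `Z`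

module Shortcuts {G : Graph} (connected : Graph.Connected G) (emb : SphereEmbedding G) (Z : Cycle G)
  (D : Subset (SphereEmbedding.f emb)) (disc : SphereEmbedding.IsDiscBoundedBy emb Z D) where
  open Graph G
  open SphereEmbedding emb
  open Rerouting connected emb Z D disc public

  start-visited : ∀ {u v} (γ : NormalCurve u v) → u ∈ visits γ
  start-visited ε       = here refl
  start-visited (_ ◅ _) = here refl

  FacesIn : ∀ {u v} → NormalCurve u v → Set
  FacesIn γ = All (λ p → Vec.lookup D (face (proj₁ p)) ≡ true) (corners γ)

  faces-in⇒ : ∀ {u v} {γ : NormalCurve u v} → ContainedIn D γ → FacesIn γ
  faces-in⇒ c = All.map Vecₚ.[]=⇒lookup (ContainedIn.faces-in c)

  initial : ∀ {vs u v x} (γ : NormalCurve u v) → FacesIn γ → (∀ {y} → y ∈ visits γ → y ∈ vs) → x ∈ visits γ → Star (ChordIn vs true) u x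
  initial ε       _        _   (here refl) = ε
  initial (_ ◅ _) _        _   (here refl) = ε
  initial (c ◅ γ) (f ∷ fs) sub (there x∈)  =
    record { chord = c ; start = sub (here refl) ; end = sub (there (start-visited γ)) ; on = f } ◅ initial γ fs (sub ∘ there) x∈

  end-visited : ∀ {u v} (γ : NormalCurve u v) → v ∈ visits γ
  end-visited ε       = here refl
  end-visited (_ ◅ γ) = there (end-visited γ)

  module _ {w : Vertex} (C : NormalCurve w w) (C-in : ContainedIn D C) where

    through-C : ∀ {a b} → (∃ λ u → u ∈ visits C × Σ (NormalCurve a u) (λ γ → curveLength γ ≤ b × ContainedIn D γ)) →
      ∀ {a′ b′} → (∃ λ u → u ∈ visits C × Σ (NormalCurve a′ u) (λ γ → curveLength γ ≤ b′ × ContainedIn D γ)) →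
      ∃ λ rs → length rs ≤ b + (curveLength C + b′) × a ∈ rs × Star (ChordIn rs true) a a′
    through-C (u , u∈ , γ , len , γ-in) (u′ , u′∈ , γ′ , len′ , γ′-in) =
      gs ++ (cs ++ gs′)
      , subst (_≤ _) (sym (trans (Listₚ.length-++ gs) (cong (length gs +_) (Listₚ.length-++ cs))))
          (ℕₚ.+-mono-≤ len (ℕₚ.+-monoʳ-≤ (length cs) len′))
      , ∈-++⁺ˡ (∈-deduplicate⁺ Finₚ._≟_ (start-visited γ))
      , initial γ (faces-in⇒ γ-in) (λ y∈ → ∈-++⁺ˡ (∈-deduplicate⁺ Finₚ._≟_ y∈)) (end-visited γ)
        -- From `u` the curve runs back along `C` to its base point `w` and out again to `u′`; both
        -- stretches stay among the vertices `cs`, listed once.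
        ◅◅ reverse ChordIn-sym (to-C u∈) ◅◅ to-C u′∈
        ◅◅ reverse ChordIn-sym (initial γ′ (faces-in⇒ γ′-in)
             (λ y∈ → ∈-++⁺ʳ gs (∈-++⁺ʳ cs (∈-deduplicate⁺ Finₚ._≟_ y∈))) (end-visited γ′))
      where
      gs cs gs′ : List Vertex
      gs  = deduplicate Finₚ._≟_ (visits γ)
      cs  = deduplicate Finₚ._≟_ (visits C)
      gs′ = deduplicate Finₚ._≟_ (visits γ′)
      to-C : ∀ {x} → x ∈ visits C → Star (ChordIn (gs ++ (cs ++ gs′)) true) w x
      to-C = initial C (faces-in⇒ C-in) (λ y∈ → ∈-++⁺ʳ gs (∈-++⁺ˡ (∈-deduplicate⁺ Finₚ._≟_ y∈)))

  head∈ : ∀ {A : Set} {x : A} p → head p ≡ just x → x ∈ p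
  head∈ (_ ∷ _) refl = here refl

  last∈ : ∀ {A : Set} {x : A} p → last p ≡ just x → x ∈ p
  last∈ (_ ∷ [])    refl = here refl
  last∈ (_ ∷ y ∷ p) eq   = there (last∈ (y ∷ p) eq)

  path-walk : ∀ {P : Vertex → Set} p {s t} → (∀ {x} → x ∈ p → P x) → head p ≡ just s → last p ≡ just t →
    Linked (Routing.AdjacentIn (whole G)) p → Star (AdjIn P) s t
  path-walk (_ ∷ [])    _  refl refl _ = ε
  path-walk (_ ∷ y ∷ p) in-P refl eq ((d , _ , at-s , at-t) ∷ lk) =
    (d , at-s , at-t , in-P (here refl) , in-P (there (here refl))) ◅ path-walk (y ∷ p) (in-P ∘ there) refl eq lk

  routed-path : ∀ {s t p} → s ∈ Cycle.vertices Z → t ∈ Cycle.vertices Z → Routing.IsPath (whole G) s t p →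
    Σ (Routed p) λ R → let open Routed R in
      (s ≡ src (z lo) × t ≡ src (z hi)) ⊎ (s ≡ src (z hi) × t ≡ src (z lo))
  routed-path {p = p} s∈ t∈ path with ∈Z⇒z s∈ | ∈Z⇒z t∈
  ... | a , a< , refl | b , b< , refl = by-order (ℕₚ.≤-total a b)
    where
    open Routing.IsPath path
    w : Star (AdjIn (_∈ p)) (src (z a)) (src (z b))
    w = path-walk p id starts ends adjacent
    by-order : a ≤ b ⊎ b ≤ a → Σ (Routed p) λ R → let open Routed R in
      (src (z a) ≡ src (z lo) × src (z b) ≡ src (z hi)) ⊎ (src (z a) ≡ src (z hi) × src (z b) ≡ src (z lo))
    by-order (inj₁ a≤b) = record { lo≤hi = a≤b ; hi<ℓ = b< ; walk = w ; lo∈ = head∈ p starts ; hi∈ = last∈ p ends } , inj₁ (refl , refl)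
    by-order (inj₂ b≤a) = record { lo≤hi = b≤a ; hi<ℓ = a< ; walk = reverse AdjIn-sym w ; lo∈ = last∈ p ends ; hi∈ = head∈ p starts } , inj₂ (refl , refl)

-- The final count and the theorem

log-positive : ∀ {n} (u v : Fin n) → u ≢ v → 1 ≤ ⌊log₂ n ⌋
log-positive {1} zero zero u≢v = ⊥-elim (u≢v refl)
log-positive {suc (suc n)} _ _ _ = subst (_≤ ⌊log₂ suc (suc n) ⌋) (⌊log₂[2^n]⌋≡n 1) (⌊log₂⌋-mono-≤ {2} {suc (suc n)} (s≤s (s≤s z≤n)))

-- The constant is `39 * 66`: with `1 ≤ x` the spacing `6 + 33 * x` is at most `39 * x`, and the
-- independent family costs a factor `ρ + ρ = 66 * x`.
final-bound : ∀ {k j N opt′} x lg → 1 ≤ x → 1 ≤ lg → k ≤ j * (33 * x + 33 * x) → j ≤ (6 + 33 * x) * N → N ≤ opt′ →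
  k ≤ 2574 * (x ^ 2 * lg) * opt′
final-bound {k} {j} {N} {opt′} x lg 1≤x 1≤lg k≤ j≤ N≤ = begin
  k                                            ≤⟨ k≤ ⟩
  j * (33 * x + 33 * x)                        ≤⟨ ℕₚ.*-monoˡ-≤ (33 * x + 33 * x) (ℕₚ.≤-trans j≤ (ℕₚ.*-mono-≤ K≤ N≤)) ⟩
  39 * x * opt′ * (33 * x + 33 * x)            ≡⟨ regroup x opt′ ⟩
  2574 * (x ^ 2 * 1) * opt′                    ≤⟨ ℕₚ.*-monoˡ-≤ opt′ (ℕₚ.*-monoʳ-≤ 2574 (ℕₚ.*-monoʳ-≤ (x ^ 2) 1≤lg)) ⟩
  2574 * (x ^ 2 * lg) * opt′                   ∎
  where
  open ℕₚ.≤-Reasoning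
  open +-*-Solver
  K≤ : 6 + 33 * x ≤ 39 * x
  K≤ = ℕₚ.≤-trans (ℕₚ.+-monoˡ-≤ (33 * x) (ℕₚ.*-monoʳ-≤ 6 1≤x)) (ℕₚ.≤-reflexive (sym (ℕₚ.*-distribʳ-+ x 6 33)))
  regroup : ∀ x o → 39 * x * o * (33 * x + 33 * x) ≡ 2574 * (x ^ 2 * 1) * o
  regroup = solve 2 (λ x o → con 39 :* x :* o :* (con 33 :* x :+ con 33 :* x) := con 2574 :* (x :^ 2 :* con 1) :* o) refl

theorem7p7 :
    ∃ λ (c : ℕ) → 0 < c ×
      ((G : Graph) (connected : Graph.Connected G) (emb : SphereEmbedding G) →
       let open Graph G
           open SphereEmbedding emb
       in
       (Δ : ℕ) → 0 < Δ →
       (L : ℕ) → IsCeilLog₁₀⁄₉ n L →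
       let Δ₀ = 20 * (L + 1) * Δ in
       (Z : Cycle G) →
       (M : List (Vertex × Vertex)) →
       (∀ {s t} → (s , t) ∈ M → s ∈ Cycle.vertices Z × t ∈ Cycle.vertices Z) →
       {w : Vertex} (C : NormalCurve w w) →
       curveLength C ≤ Δ →
       Disjoint (visits C) (Cycle.vertices Z) →
       (D : Subset f) → IsDiscBoundedBy Z D → ContainedIn D C →
       (∀ v → v ∈ Cycle.vertices Z →
         ∃ λ u → u ∈ visits C × Σ (NormalCurve v u) λ γ →
           curveLength γ ≤ 16 * Δ₀ × ContainedIn D γ × InternallyDisjoint γ C) →
       (opt opt′ : ℕ) →
       Routing.IsOPT (whole G) M opt →
       Routing.IsOPT (emptyDisc Z D) M opt′ →
       opt ≤ c * (Δ₀ ^ 2 * ⌊log₂ n ⌋) * opt′)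
theorem7p7 = 2574 , s≤s z≤n , bound
  where
  bound : (G : Graph) (connected : Graph.Connected G) (emb : SphereEmbedding G) → _
  bound G connected emb Δ 0<Δ L _ Z M M⊆Z C C-short _ D disc C-in γ opt opt′ (routable , _) (_ , maximal) =
    -- The two distinct ends of a dart of `Z` give `2 ≤ n`, hence a logarithm of at least 1.
    final-bound Δ₀ ⌊log₂ n ⌋ (ℕₚ.≤-trans 0<Δ Δ≤Δ₀) (log-positive _ _ (loopless (Cycle.first Z)))
      R.js-size (proj₂ R.residue) (maximal (length R.chosen) rerouted)
    where
    open Graph G
    open SphereEmbedding emb
    open Shortcuts connected emb Z D disc
    open Routing.Routable routable
    Δ₀ : ℕ
    Δ₀ = 20 * (L + 1) * Δ
    Δ≤Δ₀ : Δ ≤ Δ₀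
    Δ≤Δ₀ = ℕₚ.≤-trans (ℕₚ.≤-reflexive (sym (ℕₚ.*-identityˡ Δ)))
      (ℕₚ.*-monoˡ-≤ Δ (ℕₚ.*-mono-≤ {1} {20} {1} {L + 1} (s≤s z≤n) (ℕₚ.m≤n+m 1 L)))
    γ′ : ∀ {p} → p < ℓ → ∃ λ u → u ∈ visits C × Σ (NormalCurve (src (z p)) u) λ γ → curveLength γ ≤ 16 * Δ₀ × ContainedIn D γ
    γ′ p< = let u , u∈ , c , len , c-in , _ = γ _ (z∈Z (ℕₚ.<⇒≤ p<)) in u , u∈ , c , len , c-in
    inner : ∀ {p q} → p < ℓ → q < ℓ →
      ∃ λ rs → length rs ≤ 33 * Δ₀ × src (z p) ∈ rs × Star (ChordIn rs true) (src (z p)) (src (z q))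
    inner p< q< =
      let rs , len , p∈ , c = through-C C C-in (γ′ p<) (γ′ q<) in
      rs , ℕₚ.≤-trans len total , p∈ , c
      where
      total : 16 * Δ₀ + (curveLength C + 16 * Δ₀) ≤ 33 * Δ₀
      total = ℕₚ.≤-trans (ℕₚ.+-monoʳ-≤ (16 * Δ₀) (ℕₚ.+-monoˡ-≤ (16 * Δ₀) (ℕₚ.≤-trans C-short Δ≤Δ₀)))
        (ℕₚ.≤-reflexive (sym (ℕₚ.*-distribʳ-+ Δ₀ 16 17)))
    on-Z : ∀ i → proj₁ (pair i) ∈ Cycle.vertices Z × proj₂ (pair i) ∈ Cycle.vertices Z
    on-Z i = M⊆Z (demand i)
    routed : ∀ i → Σ (Routed (path i)) _
    routed i = routed-path (proj₁ (on-Z i)) (proj₂ (on-Z i)) (connects i)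
    module R = Reroute (33 * Δ₀) inner path (proj₁ ∘ routed) (λ {i} {j} → disjoint i j)
    new-path : ∀ i → _
    new-path i = R.connect (∈-lookup {xs = R.chosen} i) (proj₂ (routed (lookup R.chosen i)))
    rerouted : Routing.Routable (emptyDisc Z D) M (length R.chosen)
    rerouted = record
      { pair     = pair ∘ lookup R.chosen
      ; demand   = demand ∘ lookup R.chosen
      ; path     = proj₁ ∘ new-path
      ; connects = λ i → proj₁ (proj₂ (new-path i))
      ; disjoint = λ i j i≢j (x∈i , x∈j) → R.W-disjoint (∈-lookup i) (∈-lookup j)
          (λ eq → i≢j (unique-lookup-injective (Uniqueₚ.filter⁺ _ R.js-unique) eq))
          (proj₂ (proj₂ (new-path i)) x∈i) (proj₂ (proj₂ (new-path j)) x∈j)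
      }
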